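{- Let $A\cup B$ be a partition of a set of $n$ points in the plane into two nonempty sets $A$ and $B$, such that every $AB$-line contains at most $\ell$ of the $n$ points. Then the bivisibility graph $\mathcal{B}(A,B)$ contains a non-crossing forest with at least $\frac{n-1}{\ell-1}$ edges. In particular, if $\ell=2$ then $\mathcal{B}(A,B)$ contains a non-crossing spanning tree.
   Context: An $AB$-line is a line containing at least one point of $A$ and at least one point of $B$. For disjoint finite point sets $A,B$ in the plane, the bivisibility graph $\mathcal{B}(A,B)$ has vertex set $A\cup B$, where $v\in A$ and $w\in B$ are adjacent iff no point of $A\cup B$ lies in the open segment $vw$. Edges are drawn as straight segments; a subgraph is non-crossing if no two of its edges intersect except at a common endpoint. -}

module Defs where

open import Level using (Level; _⊔_; suc)
open import Algebra.Bundles using (CommutativeRing)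
open import Relation.Binary.Structures using (IsStrictTotalOrder)
open import Relation.Binary.Construct.Closure.ReflexiveTransitive using (Star)
open import Data.Nat using (ℕ; _≤_)
import Data.Nat
open import Data.Fin using (Fin; zero) renaming (suc to fsuc)

open import Data.Bool using (Bool; true; false)
open import Data.Product using (_×_; _,_; Σ; ∃; proj₁; proj₂)
open import Data.Sum using (_⊎_)
open import Data.List using (List; length)
open import Data.List.Membership.Propositional using (_∈_)
open import Data.List.Relation.Unary.All using (All)
open import Data.List.Relation.Unary.Unique.Propositional using (Unique)
open import Relation.Nullary using (¬_)
open import Relation.Binary.PropositionalEquality using (_≡_)

-- Ordered fields (the stdlib has none).  The paper works in ℝ²; we
-- state the theorem for points with coordinates in an arbitrary
-- ordered field.

record OrderedField (c ℓ₁ ℓ₂ : Level) : Set (Level.suc (c ⊔ ℓ₁ ⊔ ℓ₂)) where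
  field
    commutativeRing : CommutativeRing c ℓ₁
  open CommutativeRing commutativeRing public
  field
    _<_                : Carrier → Carrier → Set ℓ₂
    isStrictTotalOrder : IsStrictTotalOrder _≈_ _<_
    0<1                : 0# < 1#
    +-mono-<           : ∀ {x y} z → x < y → (x + z) < (y + z)
    *-pos              : ∀ {x y} → 0# < x → 0# < y → 0# < (x * y)
    inverse            : ∀ x → ¬ (x ≈ 0#) → ∃ λ y → (x * y) ≈ 1#

  _≤F_ : Carrier → Carrier → Set (ℓ₁ ⊔ ℓ₂)
  x ≤F y = (x < y) ⊎ (x ≈ y)

-- cyclic successor on Fin (suc m): i ↦ i + 1 mod (suc m)
next : ∀ {m} → Fin (ℕ.suc m) → Fin (ℕ.suc m)
next {m} i = nxt m i
  where
  nxt : ∀ m → Fin (ℕ.suc m) → Fin (ℕ.suc m)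
  nxt ℕ.zero zero = zero
  nxt (ℕ.suc m) zero = fsuc zero
  nxt (ℕ.suc m) (fsuc i) with nxt m i
  ... | zero = zero
  ... | fsuc j = fsuc (fsuc j)

module Plane {c ℓ₁ ℓ₂} (F : OrderedField c ℓ₁ ℓ₂) where
  open OrderedField F

  Point : Set c
  Point = Carrier × Carrier

  _≈p_ : Point → Point → Set ℓ₁
  (x₁ , y₁) ≈p (x₂ , y₂) = (x₁ ≈ x₂) × (y₁ ≈ y₂)

  interp : Point → Point → Carrier → Point
  interp (x₁ , y₁) (x₂ , y₂) t = (x₁ + t * (x₂ - x₁)) , (y₁ + t * (y₂ - y₁))

  InOpenSegment : Point → Point → Point → Set (c ⊔ ℓ₁ ⊔ ℓ₂)
  InOpenSegment p v w = Σ Carrier λ t → (0# < t) × (t < 1#) × (p ≈p interp v w t)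

  InClosedSegment : Point → Point → Point → Set (c ⊔ ℓ₁ ⊔ ℓ₂)
  InClosedSegment p v w = Σ Carrier λ t → (0# ≤F t) × (t ≤F 1#) × (p ≈p interp v w t)

  -- p lies on the line through a and b (a ≠ b): det(b - a, p - a) = 0
  OnLine : Point → Point → Point → Set ℓ₁
  OnLine (a₁ , a₂) (b₁ , b₂) (p₁ , p₂) =
    ((b₁ - a₁) * (p₂ - a₂)) ≈ ((b₂ - a₂) * (p₁ - a₁))

  -- A configuration: n distinct points P i, coloured by col
  -- (col i ≡ true means P i ∈ A, col i ≡ false means P i ∈ B).

  module Config {n : ℕ} (P : Fin n → Point) (col : Fin n → Bool) where

    ABLinesAtMost : ℕ → Set ℓ₁
    ABLinesAtMost ℓ = ∀ a b → col a ≡ true → col b ≡ false →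
      ∀ k (f : Fin k → Fin n) → (∀ i j → f i ≡ f j → i ≡ j) →
      (∀ i → OnLine (P a) (P b) (P (f i))) → k ≤ ℓ

    BivisEdge : Fin n × Fin n → Set (c ⊔ ℓ₁ ⊔ ℓ₂)
    BivisEdge (a , b) = (col a ≡ true) × (col b ≡ false) ×
      (∀ k → ¬ InOpenSegment (P k) (P a) (P b))

    Endpoint : Fin n → Fin n × Fin n → Set
    Endpoint u (a , b) = (u ≡ a) ⊎ (u ≡ b)

    NonCrossing : List (Fin n × Fin n) → Set (c ⊔ ℓ₁ ⊔ ℓ₂)
    NonCrossing E = ∀ e f → e ∈ E → f ∈ E → ¬ (e ≡ f) → ∀ x →
      InClosedSegment x (P (proj₁ e)) (P (proj₂ e)) →
      InClosedSegment x (P (proj₁ f)) (P (proj₂ f)) →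
      ∃ λ u → Endpoint u e × Endpoint u f × (x ≈p P u)

    Adj : List (Fin n × Fin n) → Fin n → Fin n → Set
    Adj E u v = ((u , v) ∈ E) ⊎ ((v , u) ∈ E)

    HasCycle : List (Fin n × Fin n) → Set
    HasCycle E = ∃ λ m → Σ (Fin (3 Data.Nat.+ m) → Fin n) λ v →
      (∀ i j → v i ≡ v j → i ≡ j) × (∀ i → Adj E (v i) (v (next i)))

    Forest : List (Fin n × Fin n) → Set
    Forest E = Unique E × ¬ HasCycle E

    Connected : List (Fin n × Fin n) → Set
    Connected E = ∀ u v → Star (Adj E) u v

    SpanningTree : List (Fin n × Fin n) → Set
    SpanningTree E = Forest E × Connected E

{-# OPTIONS --safe #-}
module Submission where

-- Let r be the lexicographically least point, say red (in A).  On every ray from r that contains a blue point (of B), take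
-- the first blue point b and join it to its predecessor on the ray.  The blue rays cut the half-plane of the points into
-- convex wedges containing only red points.  Give each wedge to the first blue point b of its clockwise bounding ray (the
-- wedge before all blue rays goes to the first one), and join b to the nearest point on each ray from b that meets a point
-- of the wedge.  These edges do not cross, and every red point except r is on at most one of them.  Each edge accounts for
-- points on a single AB-line that contains one further point, r or b, hence for at most ℓ − 1 of the n − 1 points.

open import Defs
open import Level using (Level)
open import Data.Nat using (ℕ)
open import Data.Fin using (Fin)
open import Data.Bool using (Bool; true; false; not)
open import Data.Bool.Properties using (not-involutive)
open import Data.Product using (_×_; ∃)
open import Data.List using (List; length)
open import Data.List.Relation.Unary.All using (All)
open import Relation.Binary.PropositionalEquality using (_≡_)

open import Algebra.Bundles using (CommutativeRing)
open import Algebra.Solver.Ring.AlmostCommutativeRing using (_-Raw-AlmostCommutative⟶_; fromCommutativeRing; Induced-equivalence)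
import Data.Bool as Bool
open import Data.Fin using (zero; suc; punchIn; punchOut)
open import Data.Fin.Properties as Fin using (any?; punchInᵢ≢i; punchIn-injective; punchIn-punchOut)
open import Data.Integer as ℤ using (ℤ; +_; -[1+_]; _⊖_)
import Data.Integer.Base as ℤ using (+-*-rawRing)
open import Data.Integer.Properties using ([1+m]⊖[1+n]≡m⊖n; -◃n≡-n; +◃n≡+n)
open import Data.List using ([]; _∷_; allFin; filter; tabulate; lookup; deduplicate; map)
open import Data.List.Membership.Propositional using (_∈_)
open import Data.List.Membership.Propositional.Properties
  using (∈-allFin; ∈-lookup; ∈-filter⁻; ∈-tabulate⁺; ∈-tabulate⁻; ∈-deduplicate⁺; ∈-deduplicate⁻; ∈-map⁺; ∈-map⁻)
open import Data.List.Properties using (length-map; length-tabulate)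
import Data.List.Relation.Unary.All as All
open import Data.List.Relation.Unary.All using ([]; _∷_)
import Data.List.Relation.Unary.All.Properties as All
open import Data.List.Relation.Unary.AllPairs using ([]; _∷_)
open import Data.List.Relation.Unary.Any using (tail)
open import Data.List.Relation.Unary.Unique.DecPropositional.Properties using (deduplicate-!)
open import Data.List.Relation.Unary.Unique.Propositional using (Unique)
import Data.List.Relation.Unary.Unique.Propositional.Properties as Unique
import Data.Maybe as Maybe
open import Data.Nat as ℕ using (zero; suc)
import Data.Nat.Properties as ℕ
open import Data.Product using (_,_; proj₁; proj₂; swap)
open import Data.Product.Properties using (≡-dec)
import Data.Sign as Sign
open import Data.Sum as Sum using (_⊎_; inj₁; inj₂)
open import Data.Unit using (⊤; tt)
open import Function using (_∘_; id)
import Relation.Binary.Construct.Closure.ReflexiveTransitive as Star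
open import Relation.Binary.Construct.Closure.ReflexiveTransitive using (Star; ε; _◅_; _◅◅_; reverse)
open import Relation.Binary.Definitions using (WeaklyDecidable; tri<; tri≈; tri>)
open import Relation.Binary.PropositionalEquality as ≡ using (_≢_)
open import Relation.Binary.Structures using (IsStrictTotalOrder)
open import Relation.Nullary using (¬_; Dec; yes; no; contradiction)
open import Relation.Nullary.Decidable using (dec⇒maybe; _×-dec_; ¬?; decidable-stable)

-- The obstacle is to speak of rays and their angular order over an arbitrary ordered field, with
-- neither angles nor lengths. Rays from `r` are compared by the sign of `det`, and points on one
-- ray by `dot`. The sign of `det` is transitive only while all directions stay in a cone without
-- opposite vectors. This is why the root is a lexicographic minimum: a point that merely minimises
-- the first coordinate could see two points in opposite vertical directions. Wedges are never
-- formed as regions. Both kinds of edges are reduced to the same few sign conditions, recorded in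
-- `Spoke`, and these alone yield that edges do not cross and that a red point other than `r` has a
-- single blue neighbour. Acyclicity follows from the latter, so no separate order of insertion for
-- the edges is needed.

-- Polynomial identities with integer coefficients.

module IntegerCoefficients {c ℓ} (R : CommutativeRing c ℓ) where
  open CommutativeRing R
  open import Algebra.Properties.Semiring.Mult.TCOptimised semiring using (×-homo-+; ×1-homo-*; 1+×) renaming (_×_ to _·_)
  open import Algebra.Properties.Ring ring using (-‿distribˡ-*; -‿distribʳ-*; -0#≈0#)
  open import Algebra.Properties.AbelianGroup +-abelianGroup using (⁻¹-∙-comm; ⁻¹-involutive)
  open import Algebra.Properties.CommutativeSemigroup +-commutativeSemigroup using (interchange)
  open import Relation.Binary.Reasoning.Setoid setoid

  -- The canonical ring map from the integers. Equality of integer coefficients is decidable, which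
  -- lets the ring solver cancel terms. With the optimised multiple, `+ 0` and `+ 1` evaluate
  -- definitionally to `0#` and `1#`, so solved identities match goals literally.
  ⟦_⟧ᶻ : ℤ → Carrier
  ⟦ + n ⟧ᶻ      = n · 1#
  ⟦ -[1+ n ] ⟧ᶻ = - (suc n · 1#)

  ⊖-homo : ∀ m n → ⟦ m ⊖ n ⟧ᶻ ≈ m · 1# - n · 1#
  ⊖-homo zero zero = sym (-‿inverseʳ 0#)
  ⊖-homo zero (suc n) = sym (+-identityˡ _)
  ⊖-homo (suc m) zero = sym (trans (+-congˡ -0#≈0#) (+-identityʳ _))
  ⊖-homo (suc m) (suc n) = begin
    ⟦ suc m ⊖ suc n ⟧ᶻ                ≡⟨ ≡.cong ⟦_⟧ᶻ ([1+m]⊖[1+n]≡m⊖n m n) ⟩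
    ⟦ m ⊖ n ⟧ᶻ                        ≈⟨ ⊖-homo m n ⟩
    m · 1# - n · 1#                  ≈⟨ +-identityˡ _ ⟨
    0# + (m · 1# - n · 1#)           ≈⟨ +-congʳ (-‿inverseʳ 1#) ⟨
    (1# - 1#) + (m · 1# - n · 1#)    ≈⟨ interchange _ _ _ _ ⟩
    (1# + m · 1#) + (- 1# - n · 1#)  ≈⟨ +-cong (sym (1+× m 1#)) (trans (⁻¹-∙-comm _ _) (-‿cong (sym (1+× n 1#)))) ⟩
    suc m · 1# - suc n · 1#          ∎

  +ᶻ-homo : ∀ i j → ⟦ i ℤ.+ j ⟧ᶻ ≈ ⟦ i ⟧ᶻ + ⟦ j ⟧ᶻ
  +ᶻ-homo (+ m) (+ n) = ×-homo-+ 1# m n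
  +ᶻ-homo (+ m) -[1+ n ] = ⊖-homo m (suc n)
  +ᶻ-homo -[1+ m ] (+ n) = trans (⊖-homo n (suc m)) (+-comm _ _)
  +ᶻ-homo -[1+ m ] -[1+ n ] = begin
    - (suc (suc (m ℕ.+ n)) · 1#)       ≡⟨ ≡.cong (λ k → - (suc k · 1#)) (ℕ.+-suc m n) ⟨
    - ((suc m ℕ.+ suc n) · 1#)         ≈⟨ -‿cong (×-homo-+ 1# (suc m) (suc n)) ⟩
    - (suc m · 1# + suc n · 1#)        ≈⟨ ⁻¹-∙-comm _ _ ⟨
    - (suc m · 1#) - suc n · 1#        ∎

  -ᶻ-homo : ∀ i → ⟦ ℤ.- i ⟧ᶻ ≈ - ⟦ i ⟧ᶻ
  -ᶻ-homo (+ zero) = sym -0#≈0#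
  -ᶻ-homo (+ suc n) = refl
  -ᶻ-homo -[1+ n ] = sym (⁻¹-involutive _)

  neg◃-homo : ∀ n → ⟦ Sign.- ℤ.◃ n ⟧ᶻ ≈ - (n · 1#)
  neg◃-homo n = trans (reflexive (≡.cong ⟦_⟧ᶻ (-◃n≡-n n))) (-ᶻ-homo (+ n))

  *ᶻ-homo : ∀ i j → ⟦ i ℤ.* j ⟧ᶻ ≈ ⟦ i ⟧ᶻ * ⟦ j ⟧ᶻ
  *ᶻ-homo (+ m) (+ n) = trans (reflexive (≡.cong ⟦_⟧ᶻ (+◃n≡+n (m ℕ.* n)))) (×1-homo-* m n)
  *ᶻ-homo (+ m) -[1+ n ] = begin
    ⟦ Sign.- ℤ.◃ (m ℕ.* suc n) ⟧ᶻ   ≈⟨ neg◃-homo (m ℕ.* suc n) ⟩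
    - ((m ℕ.* suc n) · 1#)          ≈⟨ -‿cong (×1-homo-* m (suc n)) ⟩
    - (m · 1# * (suc n · 1#))       ≈⟨ -‿distribʳ-* _ _ ⟩
    m · 1# * - (suc n · 1#)         ∎
  *ᶻ-homo -[1+ m ] (+ n) = begin
    ⟦ Sign.- ℤ.◃ (suc m ℕ.* n) ⟧ᶻ   ≈⟨ neg◃-homo (suc m ℕ.* n) ⟩
    - ((suc m ℕ.* n) · 1#)          ≈⟨ -‿cong (×1-homo-* (suc m) n) ⟩
    - (suc m · 1# * (n · 1#))       ≈⟨ -‿distribˡ-* _ _ ⟩
    - (suc m · 1#) * (n · 1#)       ∎
  *ᶻ-homo -[1+ m ] -[1+ n ] = begin
    (suc m ℕ.* suc n) · 1#               ≈⟨ ×1-homo-* (suc m) (suc n) ⟩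
    suc m · 1# * (suc n · 1#)            ≈⟨ ⁻¹-involutive _ ⟨
    - - (suc m · 1# * (suc n · 1#))      ≈⟨ -‿cong (-‿distribˡ-* _ _) ⟩
    - (- (suc m · 1#) * (suc n · 1#))    ≈⟨ -‿distribʳ-* _ _ ⟩
    - (suc m · 1#) * - (suc n · 1#)      ∎

  morphism : ℤ.+-*-rawRing -Raw-AlmostCommutative⟶ fromCommutativeRing R
  morphism = record
    { ⟦_⟧ = ⟦_⟧ᶻ ; +-homo = +ᶻ-homo ; *-homo = *ᶻ-homo ; -‿homo = -ᶻ-homo
    ; 0-homo = refl ; 1-homo = refl }

  coeff≟ : WeaklyDecidable (Induced-equivalence morphism)
  coeff≟ i j = Maybe.map (λ i≡j → reflexive (≡.cong ⟦_⟧ᶻ i≡j)) (dec⇒maybe (i ℤ.≟ j))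

  open import Algebra.Solver.Ring ℤ.+-*-rawRing (fromCommutativeRing R) morphism coeff≟ public
    using (solve; _:=_; _:+_; _:*_; _:-_; :-_; con; Polynomial)

-- Signs in an ordered field and linear interpolation.

module OrderedFieldProperties {c ℓ₁ ℓ₂} (F : OrderedField c ℓ₁ ℓ₂) where
  open OrderedField F renaming (_<_ to infix 4 _<_; _≤F_ to infix 4 _≤F_)
  open IntegerCoefficients commutativeRing using (solve; _:=_; _:+_; _:*_; _:-_; :-_; con)
  open import Algebra.Properties.Ring ring public using (-‿distribˡ-*; -0#≈0#)
  open import Algebra.Properties.Group +-group public using () renaming (x∙y⁻¹≈ε⇒x≈y to x-y≈0⇒x≈y; ⁻¹-involutive to -‿involutive)
  open IsStrictTotalOrder isStrictTotalOrder public
    using (compare; _<?_; _≟_; <-respˡ-≈; <-respʳ-≈)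
    renaming (trans to <-trans; irrefl to <-irrefl; asym to <-asym)

  x<y⇒0<y-x : ∀ {x y} → x < y → 0# < y - x
  x<y⇒0<y-x {x} x<y = <-respˡ-≈ (-‿inverseʳ x) (+-mono-< (- x) x<y)

  0<y-x⇒x<y : ∀ {x y} → 0# < y - x → x < y
  0<y-x⇒x<y {x} {y} 0<y-x =
    <-respˡ-≈ (+-identityˡ x) (<-respʳ-≈ (solve 2 (λ x y → (y :- x) :+ x := y) refl x y) (+-mono-< x 0<y-x))

  neg⇒-pos : ∀ {x} → x < 0# → 0# < - x
  neg⇒-pos x<0 = <-respʳ-≈ (+-identityˡ _) (x<y⇒0<y-x x<0)

  -pos⇒neg : ∀ {x} → 0# < - x → x < 0#
  -pos⇒neg 0<-x = 0<y-x⇒x<y (<-respʳ-≈ (sym (+-identityˡ _)) 0<-x)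

  pos⇒-neg : ∀ {x} → 0# < x → - x < 0#
  pos⇒-neg 0<x = -pos⇒neg (<-respʳ-≈ (sym (-‿involutive _)) 0<x)

  +-pos : ∀ {x y} → 0# < x → 0# < y → 0# < x + y
  +-pos {x} {y} 0<x 0<y = <-trans 0<y (<-respˡ-≈ (+-identityˡ y) (+-mono-< y 0<x))

  +-pos-nonneg : ∀ {x y} → 0# < x → 0# ≤F y → 0# < x + y
  +-pos-nonneg 0<x (inj₁ 0<y) = +-pos 0<x 0<y
  +-pos-nonneg 0<x (inj₂ 0≈y) = <-respʳ-≈ (trans (sym (+-identityʳ _)) (+-congˡ 0≈y)) 0<x

  *-nonneg : ∀ {x y} → 0# ≤F x → 0# ≤F y → 0# ≤F x * y
  *-nonneg (inj₁ 0<x) (inj₁ 0<y) = inj₁ (*-pos 0<x 0<y)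
  *-nonneg (inj₂ 0≈x) _ = inj₂ (trans (sym (zeroˡ _)) (*-congʳ 0≈x))
  *-nonneg _ (inj₂ 0≈y) = inj₂ (trans (sym (zeroʳ _)) (*-congˡ 0≈y))

  *-pos-neg : ∀ {x y} → 0# < x → y < 0# → x * y < 0#
  *-pos-neg {x} {y} 0<x y<0 = -pos⇒neg
    (<-respʳ-≈ (solve 2 (λ x y → x :* :- y := :- (x :* y)) refl x y) (*-pos 0<x (neg⇒-pos y<0)))

  *-neg-cancel : ∀ {x y} → 0# < x → x * y < 0# → y < 0#
  *-neg-cancel {x} {y} 0<x xy<0 with compare y 0#
  ... | tri< y<0 _ _ = y<0
  ... | tri≈ _ y≈0 _ = contradiction xy<0 (<-irrefl (trans (*-congˡ y≈0) (zeroʳ x)))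
  ... | tri> _ _ 0<y = contradiction xy<0 (<-asym (*-pos 0<x 0<y))

  square-nonneg : ∀ x → 0# ≤F x * x
  square-nonneg x with compare x 0#
  ... | tri< x<0 _ _ = inj₁ (<-respʳ-≈ (solve 1 (λ x → :- x :* :- x := x :* x) refl x) (*-pos (neg⇒-pos x<0) (neg⇒-pos x<0)))
  ... | tri≈ _ x≈0 _ = inj₂ (sym (trans (*-congˡ x≈0) (zeroʳ x)))
  ... | tri> _ _ 0<x = inj₁ (*-pos 0<x 0<x)

  square-zero : ∀ {x} → 0# ≈ x * x → x ≈ 0#
  square-zero {x} 0≈x² with compare x 0#
  ... | tri< x<0 _ _ = contradiction (*-pos (neg⇒-pos x<0) (neg⇒-pos x<0))
    (<-irrefl (trans 0≈x² (solve 1 (λ x → x :* x := :- x :* :- x) refl x)))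
  ... | tri≈ _ x≈0 _ = x≈0
  ... | tri> _ _ 0<x = contradiction (*-pos 0<x 0<x) (<-irrefl 0≈x²)

  pos-inverse : ∀ {x} → 0# < x → ∃ λ y → 0# < y × x * y ≈ 1#
  pos-inverse {x} 0<x with inverse x (λ x≈0 → <-irrefl (sym x≈0) 0<x)
  ... | y , xy≈1 with compare y 0#
  ...   | tri< y<0 _ _ = contradiction (<-respˡ-≈ xy≈1 (*-pos-neg 0<x y<0)) (<-asym 0<1)
  ...   | tri≈ _ y≈0 _ = contradiction 0<1 (<-irrefl (trans (sym (trans (*-congˡ y≈0) (zeroʳ x))) xy≈1))
  ...   | tri> _ _ 0<y = y , 0<y , xy≈1

  -- One coordinate of `interp`. The affine functions `det a b` and `dot a b` also follow this
  -- formula along a segment, so sign arguments about segments reduce to it.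
  lerp : Carrier → Carrier → Carrier → Carrier
  lerp u v t = u + t * (v - u)

  lerp-cong : ∀ {u u′ v v′} t → u ≈ u′ → v ≈ v′ → lerp u v t ≈ lerp u′ v′ t
  lerp-cong t u≈ v≈ = +-cong u≈ (*-congˡ (+-cong v≈ (-‿cong u≈)))

  lerp-0ˡ : ∀ v t → lerp 0# v t ≈ t * v
  lerp-0ˡ = solve 2 (λ v t → con (+ 0) :+ t :* (v :- con (+ 0)) := t :* v) refl

  lerp-0ʳ : ∀ u t → lerp u 0# t ≈ (1# - t) * u
  lerp-0ʳ = solve 2 (λ u t → u :+ t :* (con (+ 0) :- u) := (con (+ 1) :- t) :* u) refl

  lerp-convex : ∀ u v t → lerp u v t ≈ (1# - t) * u + t * v
  lerp-convex = solve 3 (λ u v t → u :+ t :* (v :- u) := (con (+ 1) :- t) :* u :+ t :* v) refl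

  lerp-0 : ∀ u v → lerp u v 0# ≈ u
  lerp-0 = solve 2 (λ u v → u :+ con (+ 0) :* (v :- u) := u) refl

  lerp-1 : ∀ u v → lerp u v 1# ≈ v
  lerp-1 = solve 2 (λ u v → u :+ con (+ 1) :* (v :- u) := v) refl

  lerp-flip : ∀ u v t → lerp u v t ≈ lerp v u (1# - t)
  lerp-flip = solve 3 (λ u v t → u :+ t :* (v :- u) := v :+ (con (+ 1) :- t) :* (u :- v)) refl

  lerp-pos : ∀ {u v t} → 0# < u → 0# < v → 0# ≤F t → t ≤F 1# → 0# < lerp u v t
  lerp-pos {u} {v} {t} 0<u 0<v 0≤t (inj₁ t<1) = <-respʳ-≈ (sym (lerp-convex u v t))
    (+-pos-nonneg (*-pos (x<y⇒0<y-x t<1) 0<u) (*-nonneg 0≤t (inj₁ 0<v)))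
  lerp-pos {u} {v} {t} 0<u 0<v 0≤t (inj₂ t≈1) = <-respʳ-≈ (sym (trans (+-congˡ (*-congʳ t≈1)) (lerp-1 u v))) 0<v

  lerp-neg : ∀ {u v t} → u < 0# → v < 0# → 0# ≤F t → t ≤F 1# → lerp u v t < 0#
  lerp-neg {u} {v} {t} u<0 v<0 0≤t t≤1 = -pos⇒neg (<-respʳ-≈
    (solve 3 (λ u v t → :- u :+ t :* (:- v :- :- u) := :- (u :+ t :* (v :- u))) refl u v t)
    (lerp-pos (neg⇒-pos u<0) (neg⇒-pos v<0) 0≤t t≤1))

-- Orientation, collinearity and segments.

module PlaneGeometry {c ℓ₁ ℓ₂} (F : OrderedField c ℓ₁ ℓ₂) where
  open OrderedField F renaming (_<_ to infix 4 _<_; _≤F_ to infix 4 _≤F_)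
  open Plane F
  open OrderedFieldProperties F
  open IntegerCoefficients commutativeRing using (solve; _:=_; _:+_; _:*_; _:-_; :-_; con; Polynomial)

  ≈p-sym : ∀ {p q} → p ≈p q → q ≈p p
  ≈p-sym (e₁ , e₂) = sym e₁ , sym e₂

  ≈p-trans : ∀ {p q s} → p ≈p q → q ≈p s → p ≈p s
  ≈p-trans (e₁ , e₂) (e₁′ , e₂′) = trans e₁ e₁′ , trans e₂ e₂′

  interp-flip : ∀ v w t → interp v w t ≈p interp w v (1# - t)
  interp-flip (v₁ , v₂) (w₁ , w₂) t = lerp-flip v₁ w₁ t , lerp-flip v₂ w₂ t

  interp-start : ∀ {x v w t} → x ≈p interp v w t → t ≈ 0# → x ≈p v
  interp-start (e₁ , e₂) t≈0 = coord e₁ , coord e₂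
    where
    coord : ∀ {x v w} → x ≈ lerp v w _ → x ≈ v
    coord e = trans e (trans (+-congˡ (*-congʳ t≈0)) (lerp-0 _ _))

  interp-end : ∀ {x v w t} → x ≈p interp v w t → t ≈ 1# → x ≈p w
  interp-end (e₁ , e₂) t≈1 = coord e₁ , coord e₂
    where
    coord : ∀ {x v w} → x ≈ lerp v w _ → x ≈ w
    coord e = trans e (trans (+-congˡ (*-congʳ t≈1)) (lerp-1 _ _))

  open-flip : ∀ {p v w} → InOpenSegment p v w → InOpenSegment p w v
  open-flip {p} {v} {w} (t , 0<t , t<1 , e) =
    1# - t , x<y⇒0<y-x t<1 , 0<y-x⇒x<y (<-respʳ-≈ (sym 1-[1-t]≈t) 0<t) , ≈p-trans {p} e (interp-flip v w t)
    where 1-[1-t]≈t = solve 1 (λ t → con (+ 1) :- (con (+ 1) :- t) := t) refl t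

  closed-flip : ∀ {p v w} → InClosedSegment p v w → InClosedSegment p w v
  closed-flip {p} {v} {w} (t , 0≤t , t≤1 , e) =
    1# - t , 0≤1-t t≤1 , 1-t≤1 0≤t , ≈p-trans {p} e (interp-flip v w t)
    where
    0≤1-t : t ≤F 1# → 0# ≤F 1# - t
    0≤1-t (inj₁ t<1) = inj₁ (x<y⇒0<y-x t<1)
    0≤1-t (inj₂ t≈1) = inj₂ (sym (trans (+-congˡ (-‿cong t≈1)) (-‿inverseʳ 1#)))
    1-t≤1 : 0# ≤F t → 1# - t ≤F 1#
    1-t≤1 (inj₁ 0<t) = inj₁ (0<y-x⇒x<y (<-respʳ-≈ (solve 1 (λ t → t := con (+ 1) :- (con (+ 1) :- t)) refl t) 0<t))
    1-t≤1 (inj₂ 0≈t) = inj₂ (trans (+-congˡ (trans (-‿cong (sym 0≈t)) -0#≈0#)) (+-identityʳ 1#))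

  abstract
    -- Twice the signed area of the triangle, positive when `p` lies to the left of the line
    -- directed from `a` to `b`. Abstract, like `dot`, so that later goals do not unfold into
    -- coordinates.
    det : Point → Point → Point → Carrier
    det (a₁ , a₂) (b₁ , b₂) (p₁ , p₂) = (b₁ - a₁) * (p₂ - a₂) - (b₂ - a₂) * (p₁ - a₁)

    dot : Point → Point → Point → Carrier
    dot (v₁ , v₂) (w₁ , w₂) (y₁ , y₂) = (w₁ - v₁) * (y₁ - v₁) + (w₂ - v₂) * (y₂ - v₂)

  private
    :det : ∀ {n} (a₁ a₂ b₁ b₂ p₁ p₂ : Polynomial n) → Polynomial n
    :det a₁ a₂ b₁ b₂ p₁ p₂ = (b₁ :- a₁) :* (p₂ :- a₂) :- (b₂ :- a₂) :* (p₁ :- a₁)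

    :dot : ∀ {n} (v₁ v₂ w₁ w₂ y₁ y₂ : Polynomial n) → Polynomial n
    :dot v₁ v₂ w₁ w₂ y₁ y₂ = (w₁ :- v₁) :* (y₁ :- v₁) :+ (w₂ :- v₂) :* (y₂ :- v₂)

    :lerp : ∀ {n} (u v t : Polynomial n) → Polynomial n
    :lerp u v t = u :+ t :* (v :- u)

  abstract
    det≈0⇒OnLine : ∀ {a b p} → det a b p ≈ 0# → OnLine a b p
    det≈0⇒OnLine = x-y≈0⇒x≈y _ _

    OnLine⇒det≈0 : ∀ {a b p} → OnLine a b p → det a b p ≈ 0#
    OnLine⇒det≈0 line = trans (+-congʳ line) (-‿inverseʳ _)

    det-congʳ : ∀ a b {p q} → p ≈p q → det a b p ≈ det a b q
    det-congʳ a b (e₁ , e₂) = +-cong (*-congˡ (+-congʳ e₂)) (-‿cong (*-congˡ (+-congʳ e₁)))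

    dot-congʳ : ∀ v w {p q} → p ≈p q → dot v w p ≈ dot v w q
    dot-congʳ v w (e₁ , e₂) = +-cong (*-congˡ (+-congʳ e₁)) (*-congˡ (+-congʳ e₂))

    det-cycle : ∀ a b p → det a b p ≈ det b p a
    det-cycle (a₁ , a₂) (b₁ , b₂) (p₁ , p₂) =
      solve 6 (λ a₁ a₂ b₁ b₂ p₁ p₂ → :det a₁ a₂ b₁ b₂ p₁ p₂ := :det b₁ b₂ p₁ p₂ a₁ a₂) refl a₁ a₂ b₁ b₂ p₁ p₂

    det-swap : ∀ a b p → det a p b ≈ - det a b p
    det-swap (a₁ , a₂) (b₁ , b₂) (p₁ , p₂) =
      solve 6 (λ a₁ a₂ b₁ b₂ p₁ p₂ → :det a₁ a₂ p₁ p₂ b₁ b₂ := :- :det a₁ a₂ b₁ b₂ p₁ p₂) refl a₁ a₂ b₁ b₂ p₁ p₂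

    OnLine-flip : ∀ {a b p} → OnLine b a p → OnLine a b p
    OnLine-flip {a} {b} {p} line = det≈0⇒OnLine {a} {b} {p} (trans (det-cycle a b p) (trans (det-swap b a p)
      (trans (-‿cong (OnLine⇒det≈0 {b} {a} {p} line)) -0#≈0#)))

    det-aba : ∀ a b → det a b a ≈ 0#
    det-aba (a₁ , a₂) (b₁ , b₂) =
      solve 4 (λ a₁ a₂ b₁ b₂ → :det a₁ a₂ b₁ b₂ a₁ a₂ := con (+ 0)) refl a₁ a₂ b₁ b₂

    det-abb : ∀ a b → det a b b ≈ 0#
    det-abb (a₁ , a₂) (b₁ , b₂) =
      solve 4 (λ a₁ a₂ b₁ b₂ → :det a₁ a₂ b₁ b₂ b₁ b₂ := con (+ 0)) refl a₁ a₂ b₁ b₂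

    det-interp : ∀ a b v w t → det a b (interp v w t) ≈ lerp (det a b v) (det a b w) t
    det-interp (a₁ , a₂) (b₁ , b₂) (v₁ , v₂) (w₁ , w₂) =
      solve 9 (λ a₁ a₂ b₁ b₂ v₁ v₂ w₁ w₂ t →
        :det a₁ a₂ b₁ b₂ (:lerp v₁ w₁ t) (:lerp v₂ w₂ t) := :lerp (:det a₁ a₂ b₁ b₂ v₁ v₂) (:det a₁ a₂ b₁ b₂ w₁ w₂) t)
        refl a₁ a₂ b₁ b₂ v₁ v₂ w₁ w₂

    dot-interp : ∀ a b v w t → dot a b (interp v w t) ≈ lerp (dot a b v) (dot a b w) t
    dot-interp (a₁ , a₂) (b₁ , b₂) (v₁ , v₂) (w₁ , w₂) =
      solve 9 (λ a₁ a₂ b₁ b₂ v₁ v₂ w₁ w₂ t →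
        :dot a₁ a₂ b₁ b₂ (:lerp v₁ w₁ t) (:lerp v₂ w₂ t) := :lerp (:dot a₁ a₂ b₁ b₂ v₁ v₂) (:dot a₁ a₂ b₁ b₂ w₁ w₂) t)
        refl a₁ a₂ b₁ b₂ v₁ v₂ w₁ w₂

    dot-vwv : ∀ v w → dot v w v ≈ 0#
    dot-vwv (v₁ , v₂) (w₁ , w₂) =
      solve 4 (λ v₁ v₂ w₁ w₂ → :dot v₁ v₂ w₁ w₂ v₁ v₂ := con (+ 0)) refl v₁ v₂ w₁ w₂

    dot-pos : ∀ v w → ¬ (v ≈p w) → 0# < dot v w w
    dot-pos (v₁ , v₂) (w₁ , w₂) v≉w with square-nonneg (w₁ - v₁) | square-nonneg (w₂ - v₂)
    ... | inj₁ 0<d₁² | 0≤d₂² = +-pos-nonneg 0<d₁² 0≤d₂²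
    ... | inj₂ 0≈d₁² | inj₁ 0<d₂² = <-respʳ-≈ (+-comm _ _) (+-pos-nonneg 0<d₂² (inj₂ 0≈d₁²))
    ... | inj₂ 0≈d₁² | inj₂ 0≈d₂² = contradiction
      (sym (x-y≈0⇒x≈y w₁ v₁ (square-zero 0≈d₁²)) , sym (x-y≈0⇒x≈y w₂ v₂ (square-zero 0≈d₂²))) v≉w

    -- Orthogonal decomposition: `dot v w w` times the vector from `v` to `y` is `dot v w y` times
    -- the vector from `v` to `w`, plus `det v w y` times that vector turned by a right angle. The
    -- second term vanishes, and `i` is the reciprocal of the squared length.
    collinear⇒interp : ∀ {v w} y → ¬ (v ≈p w) → det v w y ≈ 0# →
      ∃ λ i → 0# < i × dot v w w * i ≈ 1# × y ≈p interp v w (dot v w y * i)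
    collinear⇒interp {v@(v₁ , v₂)} {w@(w₁ , w₂)} y@(y₁ , y₂) v≉w det≈0 with pos-inverse (dot-pos v w v≉w)
    ... | i , 0<i , Ni≈1 = i , 0<i , Ni≈1 , fst , snd
      where
      fst : y₁ ≈ v₁ + dot v w y * i * (w₁ - v₁)
      fst = begin
        y₁                                                                ≈⟨ solve 2 (λ y v → y := v :+ (y :- v) :* con (+ 1)) refl y₁ v₁ ⟩
        v₁ + (y₁ - v₁) * 1#                                               ≈⟨ +-congˡ (*-congˡ Ni≈1) ⟨
        v₁ + (y₁ - v₁) * (dot v w w * i)                                  ≈⟨ solve 7 (λ v₁ v₂ w₁ w₂ y₁ y₂ i →
          v₁ :+ (y₁ :- v₁) :* (:dot v₁ v₂ w₁ w₂ w₁ w₂ :* i) :=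
          v₁ :+ :dot v₁ v₂ w₁ w₂ y₁ y₂ :* i :* (w₁ :- v₁) :- :det v₁ v₂ w₁ w₂ y₁ y₂ :* (i :* (w₂ :- v₂))) refl v₁ v₂ w₁ w₂ y₁ y₂ i ⟩
        v₁ + dot v w y * i * (w₁ - v₁) - det v w y * (i * (w₂ - v₂))      ≈⟨ +-congˡ (-‿cong (trans (*-congʳ det≈0) (zeroˡ _))) ⟩
        v₁ + dot v w y * i * (w₁ - v₁) - 0#                               ≈⟨ trans (+-congˡ -0#≈0#) (+-identityʳ _) ⟩
        v₁ + dot v w y * i * (w₁ - v₁)                                    ∎
        where open import Relation.Binary.Reasoning.Setoid setoid
      snd : y₂ ≈ v₂ + dot v w y * i * (w₂ - v₂)
      snd = begin
        y₂                                                                ≈⟨ solve 2 (λ y v → y := v :+ (y :- v) :* con (+ 1)) refl y₂ v₂ ⟩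
        v₂ + (y₂ - v₂) * 1#                                               ≈⟨ +-congˡ (*-congˡ Ni≈1) ⟨
        v₂ + (y₂ - v₂) * (dot v w w * i)                                  ≈⟨ solve 7 (λ v₁ v₂ w₁ w₂ y₁ y₂ i →
          v₂ :+ (y₂ :- v₂) :* (:dot v₁ v₂ w₁ w₂ w₁ w₂ :* i) :=
          v₂ :+ :dot v₁ v₂ w₁ w₂ y₁ y₂ :* i :* (w₂ :- v₂) :+ :det v₁ v₂ w₁ w₂ y₁ y₂ :* (i :* (w₁ :- v₁))) refl v₁ v₂ w₁ w₂ y₁ y₂ i ⟩
        v₂ + dot v w y * i * (w₂ - v₂) + det v w y * (i * (w₁ - v₁))      ≈⟨ +-congˡ (trans (*-congʳ det≈0) (zeroˡ _)) ⟩
        v₂ + dot v w y * i * (w₂ - v₂) + 0#                               ≈⟨ +-identityʳ _ ⟩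
        v₂ + dot v w y * i * (w₂ - v₂)                                    ∎
        where open import Relation.Binary.Reasoning.Setoid setoid

  scale : ∀ {x v w s} → x ≈p interp v w s → ∀ q → det v x q ≈ s * det v w q
  scale {x} {v@(v₁ , v₂)} {w@(w₁ , w₂)} {s} x≈ q@(q₁ , q₂) = begin
    det v x q                          ≈⟨ det-cycle v x q ⟩
    det x q v                          ≈⟨ det-cycle x q v ⟩
    det q v x                          ≈⟨ det-congʳ q v x≈ ⟩
    det q v (interp v w s)             ≈⟨ det-interp q v v w s ⟩
    lerp (det q v v) (det q v w) s     ≈⟨ lerp-cong s (det-abb q v) (sym (trans (det-cycle v w q) (det-cycle w q v))) ⟩
    lerp 0# (det v w q) s              ≈⟨ lerp-0ˡ _ s ⟩
    s * det v w q                      ∎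
    where open import Relation.Binary.Reasoning.Setoid setoid

  interp-inverse : ∀ {w w′ v t i} → t * i ≈ 1# → w′ ≈p interp v w t → w ≈p interp v w′ i
  interp-inverse {w₁ , w₂} {w₁′ , w₂′} {v₁ , v₂} {t} {i} ti≈1 (e₁ , e₂) = coord e₁ , coord e₂
    where
    open import Relation.Binary.Reasoning.Setoid setoid
    coord : ∀ {w w′ v} → w′ ≈ v + t * (w - v) → w ≈ v + i * (w′ - v)
    coord {w} {w′} {v} e = begin
      w                                  ≈⟨ solve 2 (λ w v → w := v :+ con (+ 1) :* (w :- v)) refl w v ⟩
      v + 1# * (w - v)                   ≈⟨ +-congˡ (*-congʳ ti≈1) ⟨
      v + t * i * (w - v)                ≈⟨ solve 4 (λ w v t i → v :+ t :* i :* (w :- v) := v :+ i :* (v :+ t :* (w :- v) :- v)) refl w v t i ⟩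
      v + i * (v + t * (w - v) - v)      ≈⟨ +-congˡ (*-congˡ (+-congʳ e)) ⟨
      v + i * (w′ - v)                   ∎

  interp-compose : ∀ {x y v w s t} → y ≈p interp v w s → x ≈p interp v y t → x ≈p interp v w (s * t)
  interp-compose (y₁ , y₂) (x₁ , x₂) = coord y₁ x₁ , coord y₂ x₂
    where
    coord : ∀ {x y v w s t} → y ≈ v + s * (w - v) → x ≈ v + t * (y - v) → x ≈ v + s * t * (w - v)
    coord {x} {y} {v} {w} {s} {t} ey ex = trans ex (trans (+-congˡ (*-congˡ (+-congʳ ey)))
      (solve 4 (λ v w s t → v :+ t :* (v :+ s :* (w :- v) :- v) := v :+ s :* t :* (w :- v)) refl v w s t))

  same-ray : ∀ {v w w′ t} → 0# < t → w′ ≈p interp v w t → InOpenSegment w′ v w ⊎ w′ ≈p w ⊎ InOpenSegment w v w′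
  same-ray {v} {w} {w′} {t} 0<t e with compare t 1#
  ... | tri< t<1 _ _ = inj₁ (t , 0<t , t<1 , e)
  ... | tri≈ _ t≈1 _ = inj₂ (inj₁ (interp-end {w′} {v} {w} {t} e t≈1))
  ... | tri> _ _ 1<t with pos-inverse 0<t
  ...   | i , 0<i , ti≈1 = inj₂ (inj₂ (i , 0<i , i<1 , interp-inverse {w} {w′} {v} ti≈1 e))
    where
    i<1 : i < 1#
    i<1 = <-respʳ-≈ ti≈1 (0<y-x⇒x<y (<-respʳ-≈ (solve 2 (λ t i → i :* (t :- con (+ 1)) := t :* i :- i) refl t i)
      (*-pos 0<i (x<y⇒0<y-x 1<t))))

  -- The lexicographic cone and its angular order.

  LexPos : Carrier → Carrier → Set (ℓ₁ Level.⊔ ℓ₂)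
  LexPos u v = 0# < u ⊎ (0# ≈ u × 0# < v)

  lex-resp : ∀ {u u′ v v′} → u ≈ u′ → v ≈ v′ → LexPos u v → LexPos u′ v′
  lex-resp u≈ v≈ (inj₁ 0<u) = inj₁ (<-respʳ-≈ u≈ 0<u)
  lex-resp u≈ v≈ (inj₂ (0≈u , 0<v)) = inj₂ (trans 0≈u u≈ , <-respʳ-≈ v≈ 0<v)

  lex-≉0 : ∀ {u v} → LexPos u v → u ≈ 0# → ¬ (v ≈ 0#)
  lex-≉0 (inj₁ 0<u) u≈0 _ = <-irrefl (sym u≈0) 0<u
  lex-≉0 (inj₂ (_ , 0<v)) _ v≈0 = <-irrefl (sym v≈0) 0<v

  lex-+ : ∀ {u u′ v v′} → LexPos u v → LexPos u′ v′ → LexPos (u + u′) (v + v′)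
  lex-+ (inj₁ 0<u) (inj₁ 0<u′) = inj₁ (+-pos 0<u 0<u′)
  lex-+ (inj₁ 0<u) (inj₂ (0≈u′ , _)) = inj₁ (+-pos-nonneg 0<u (inj₂ 0≈u′))
  lex-+ (inj₂ (0≈u , _)) (inj₁ 0<u′) = inj₁ (<-respʳ-≈ (+-comm _ _) (+-pos-nonneg 0<u′ (inj₂ 0≈u)))
  lex-+ (inj₂ (0≈u , 0<v)) (inj₂ (0≈u′ , 0<v′)) = inj₂ (trans (sym (+-identityʳ 0#)) (+-cong 0≈u 0≈u′) , +-pos 0<v 0<v′)

  lex-* : ∀ {k u v} → 0# < k → LexPos u v → LexPos (k * u) (k * v)
  lex-* 0<k (inj₁ 0<u) = inj₁ (*-pos 0<k 0<u)
  lex-* 0<k (inj₂ (0≈u , 0<v)) = inj₂ (trans (sym (zeroʳ _)) (*-congˡ 0≈u) , *-pos 0<k 0<v)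

  -- The cone is closed under sums and positive multiples and omits zero. For negative `k`, adding
  -- `- k` times the first vector to the second would place zero in the cone.
  lex-*-cancel : ∀ {k u v} → LexPos u v → LexPos (k * u) (k * v) → 0# < k
  lex-*-cancel {k} {u} {v} lex lexk with compare k 0#
  ... | tri> _ _ 0<k = 0<k
  ... | tri≈ _ k≈0 _ = contradiction (trans (*-congʳ k≈0) (zeroˡ v)) (lex-≉0 lexk (trans (*-congʳ k≈0) (zeroˡ u)))
  ... | tri< k<0 _ _ = contradiction (cancel v) (lex-≉0 (lex-+ (lex-* (neg⇒-pos k<0) lex) lexk) (cancel u))
    where
    cancel : ∀ x → - k * x + k * x ≈ 0#
    cancel = solve 2 (λ k x → :- k :* x :+ k :* x := con (+ 0)) refl k

  lex-lerp : ∀ {u u′ v v′ t} → LexPos u v → LexPos u′ v′ → 0# ≤F t → t ≤F 1# → LexPos (lerp u u′ t) (lerp v v′ t)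
  lex-lerp {u} {u′} {v} {v′} {t} lex lex′ (inj₂ 0≈t) _ = lex-resp (atStart u u′) (atStart v v′) lex
    where
    atStart : ∀ x x′ → x ≈ lerp x x′ t
    atStart x x′ = trans (sym (lerp-0 x x′)) (+-congˡ (*-congʳ 0≈t))
  lex-lerp {u} {u′} {v} {v′} {t} lex lex′ _ (inj₂ t≈1) = lex-resp (atEnd u u′) (atEnd v v′) lex′
    where
    atEnd : ∀ x x′ → x′ ≈ lerp x x′ t
    atEnd x x′ = trans (sym (lerp-1 x x′)) (+-congˡ (*-congʳ (sym t≈1)))
  lex-lerp {u} {u′} {v} {v′} {t} lex lex′ (inj₁ 0<t) (inj₁ t<1) =
    lex-resp (sym (lerp-convex u u′ t)) (sym (lerp-convex v v′ t)) (lex-+ (lex-* (x<y⇒0<y-x t<1) lex) (lex-* 0<t lex′))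

  abstract
    Beyond : Point → Point → Set (ℓ₁ Level.⊔ ℓ₂)
    Beyond (p₁ , p₂) (q₁ , q₂) = LexPos (q₁ - p₁) (q₂ - p₂)

    beyond-irrefl : ∀ {p q} → p ≈p q → ¬ Beyond p q
    beyond-irrefl {p₁ , p₂} {q₁ , q₂} (e₁ , e₂) p≺q = lex-≉0 p≺q (diff e₁) (diff e₂)
      where
      diff : ∀ {x y} → x ≈ y → y - x ≈ 0#
      diff x≈y = trans (+-congʳ (sym x≈y)) (-‿inverseʳ _)

    beyond-trans : ∀ {p q s} → Beyond p q → Beyond q s → Beyond p s
    beyond-trans {p₁ , p₂} {q₁ , q₂} {s₁ , s₂} p≺q q≺s = lex-resp (add p₁ q₁ s₁) (add p₂ q₂ s₂) (lex-+ p≺q q≺s)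
      where
      add : ∀ p q s → q - p + (s - q) ≈ s - p
      add = solve 3 (λ p q s → q :- p :+ (s :- q) := s :- p) refl

    beyond-compare : ∀ p q → Beyond p q ⊎ p ≈p q ⊎ Beyond q p
    beyond-compare (p₁ , p₂) (q₁ , q₂) with compare p₁ q₁ | compare p₂ q₂
    ... | tri< p₁<q₁ _ _ | _ = inj₁ (inj₁ (x<y⇒0<y-x p₁<q₁))
    ... | tri> _ _ q₁<p₁ | _ = inj₂ (inj₂ (inj₁ (x<y⇒0<y-x q₁<p₁)))
    ... | tri≈ _ p₁≈q₁ _ | tri< p₂<q₂ _ _ = inj₁ (inj₂ (sym (trans (+-congˡ (-‿cong p₁≈q₁)) (-‿inverseʳ q₁)) , x<y⇒0<y-x p₂<q₂))
    ... | tri≈ _ p₁≈q₁ _ | tri≈ _ p₂≈q₂ _ = inj₂ (inj₁ (p₁≈q₁ , p₂≈q₂))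
    ... | tri≈ _ p₁≈q₁ _ | tri> _ _ q₂<p₂ = inj₂ (inj₂ (inj₂ (sym (trans (+-congʳ p₁≈q₁) (-‿inverseʳ q₁)) , x<y⇒0<y-x q₂<p₂)))

  beyond? : ∀ p q → Dec (Beyond p q)
  beyond? p q with beyond-compare p q
  ... | inj₁ p≺q = yes p≺q
  ... | inj₂ (inj₁ p≈q) = no (beyond-irrefl p≈q)
  ... | inj₂ (inj₂ q≺p) = no (λ p≺q → beyond-irrefl (refl , refl) (beyond-trans {p} {q} {p} p≺q q≺p))

  -- (s × p) q = (s × q) p + (q × p) s for the cross product of plane vectors, in each coordinate.
  plücker₁ : ∀ p₁ p₂ q₁ q₂ s₁ s₂ →
    - (s₁ * q₂ - s₂ * q₁) * p₁ + - (q₁ * p₂ - q₂ * p₁) * s₁ ≈ - (s₁ * p₂ - s₂ * p₁) * q₁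
  plücker₁ = solve 6 (λ p₁ p₂ q₁ q₂ s₁ s₂ →
    :- (s₁ :* q₂ :- s₂ :* q₁) :* p₁ :+ :- (q₁ :* p₂ :- q₂ :* p₁) :* s₁ := :- (s₁ :* p₂ :- s₂ :* p₁) :* q₁) refl

  plücker₂ : ∀ p₁ p₂ q₁ q₂ s₁ s₂ →
    - (s₁ * q₂ - s₂ * q₁) * p₂ + - (q₁ * p₂ - q₂ * p₁) * s₂ ≈ - (s₁ * p₂ - s₂ * p₁) * q₂
  plücker₂ = solve 6 (λ p₁ p₂ q₁ q₂ s₁ s₂ →
    :- (s₁ :* q₂ :- s₂ :* q₁) :* p₂ :+ :- (q₁ :* p₂ :- q₂ :* p₁) :* s₂ := :- (s₁ :* p₂ :- s₂ :* p₁) :* q₂) refl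

  abstract
    -- For vectors based at `r`, the two hypotheses on signs make the left side of the three-term
    -- identity a positive combination of `p` and `s`, hence a vector of the cone. It is a multiple
    -- of `q`, which lies in the cone too, so the multiplier `- det r s p` is positive.
    det-trans : ∀ {r p q s} → Beyond r p → Beyond r q → Beyond r s → det r q p < 0# → det r s q < 0# → det r s p < 0#
    det-trans {r₁ , r₂} {p₁ , p₂} {q₁ , q₂} {s₁ , s₂} r≺p r≺q r≺s qp<0 sq<0 =
      -pos⇒neg (lex-*-cancel r≺q (lex-resp
        (plücker₁ (p₁ - r₁) (p₂ - r₂) (q₁ - r₁) (q₂ - r₂) (s₁ - r₁) (s₂ - r₂))
        (plücker₂ (p₁ - r₁) (p₂ - r₂) (q₁ - r₁) (q₂ - r₂) (s₁ - r₁) (s₂ - r₂))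
        (lex-+ (lex-* (neg⇒-pos sq<0) r≺p) (lex-* (neg⇒-pos qp<0) r≺s))))

    -- The vector from `r` to `x` is a convex combination of two vectors of a convex cone that omits
    -- zero.
    beyond-segment : ∀ {r x f b} → Beyond r f → Beyond r b → InClosedSegment x f b → ¬ (x ≈p r)
    beyond-segment {r₁ , r₂} {x₁ , x₂} {f₁ , f₂} {b₁ , b₂} r≺f r≺b (t , 0≤t , t≤1 , e₁ , e₂) (x₁≈r₁ , x₂≈r₂) =
      lex-≉0 (lex-lerp r≺f r≺b 0≤t t≤1) (vanish f₁ b₁ (trans (sym e₁) x₁≈r₁)) (vanish f₂ b₂ (trans (sym e₂) x₂≈r₂))
      where
      open import Relation.Binary.Reasoning.Setoid setoid
      vanish : ∀ {r} f b → lerp f b t ≈ r → lerp (f - r) (b - r) t ≈ 0#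
      vanish {r} f b e = begin
        lerp (f - r) (b - r) t   ≈⟨ solve 4 (λ f b r t → :lerp (f :- r) (b :- r) t := :lerp f b t :- r) refl f b r t ⟩
        lerp f b t - r           ≈⟨ +-congʳ e ⟩
        r - r                    ≈⟨ -‿inverseʳ r ⟩
        0#                       ∎

    same-ray-beyond : ∀ {r w w′} → Beyond r w → Beyond r w′ → det r w w′ ≈ 0# → ∃ λ t → 0# < t × w′ ≈p interp r w t
    same-ray-beyond {r@(r₁ , r₂)} {w@(w₁ , w₂)} {w′@(w₁′ , w₂′)} r≺w r≺w′ det≈0 =
      positive (collinear⇒interp {r} {w} w′ (λ r≈w → beyond-irrefl {r} {w} r≈w r≺w) det≈0)
      where
      diff : ∀ {x r t d} → x ≈ r + t * d → x - r ≈ t * d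
      diff {x} {r} {t} {d} e = trans (+-congʳ e) (solve 3 (λ r t d → r :+ t :* d :- r := t :* d) refl r t d)
      positive : (∃ λ i → 0# < i × dot r w w * i ≈ 1# × w′ ≈p interp r w (dot r w w′ * i)) →
        ∃ λ t → 0# < t × w′ ≈p interp r w t
      positive (i , _ , _ , (e₁ , e₂)) = t , lex-*-cancel {t} {w₁ - r₁} {w₂ - r₂} r≺w
        (lex-resp (diff {w₁′} {r₁} {t} {w₁ - r₁} e₁) (diff {w₂′} {r₂} {t} {w₂ - r₂} e₂) r≺w′) , (e₁ , e₂)
        where
        t : Carrier
        t = dot r w w′ * i

-- Minimal elements and nearest points on rays.

minimal : ∀ {n q ρ} {Q : Fin n → Set q} {R : Fin n → Fin n → Set ρ} →
  (∀ i → Dec (Q i)) → (∀ i j → Dec (R i j)) →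
  (∀ {i} → Q i → ¬ R i i) → (∀ {i j k} → Q i → Q j → Q k → R i j → R j k → R i k) →
  ∀ {x} → Q x → ∃ λ m → Q m × (∀ y → Q y → ¬ R y m)
minimal {n} {Q = Q} {R} Q? R? R-irrefl R-trans {x} Qx with search (allFin n)
  where
  search : ∀ xs → ∃ λ m → Q m × All (λ y → Q y → ¬ R y m) xs
  -- The default `x` is compared later, as a member of `allFin n`.
  search [] = x , Qx , []
  search (y ∷ ys) with search ys
  ... | m , Qm , low with Q? y | R? y m
  ...   | no ¬Qy | _ = m , Qm , (λ Qy → contradiction Qy ¬Qy) ∷ low
  ...   | yes _ | no ¬Rym = m , Qm , (λ _ → ¬Rym) ∷ low
  -- Whatever is not below the old `m` is not below the smaller `y`. Transitivity is asked on `Q`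
  -- only, because the angular order is shown transitive only away from `r`.
  ...   | yes Qy | yes Rym = y , Qy , R-irrefl ∷ All.map (λ ¬Rzm Qz Rzy → ¬Rzm Qz (R-trans Qz Qy Qm Rzy Rym)) low
... | m , Qm , low = m , Qm , λ y → All.lookup low (∈-allFin y)

module PointConfiguration {c ℓ₁ ℓ₂} (F : OrderedField c ℓ₁ ℓ₂) {n : ℕ} (P : Fin n → Plane.Point F)
  (P-injective : ∀ i j → Plane._≈p_ F (P i) (P j) → i ≡ j) where
  open OrderedField F hiding (zero) renaming (_<_ to infix 4 _<_; _≤F_ to infix 4 _≤F_)
  open Plane F
  open OrderedFieldProperties F
  open IntegerCoefficients commutativeRing using (solve; _:=_; _:*_; _:-_; con)
  open PlaneGeometry F

  -- Points on the ray are ordered by their inner product with its direction, which avoids square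
  -- roots. Since `w` itself competes, the minimiser satisfies `s ≤F 1#`; a point of `C` in front of
  -- it would have a smaller positive inner product.
  first-seen : ∀ {q} {C : Fin n → Set q} → (∀ i → Dec (C i)) → ∀ v {w} → C w → ¬ (v ≈p P w) →
    ∃ λ f → C f × (∃ λ s → 0# < s × s ≤F 1# × P f ≈p interp v (P w) s) × (∀ y → C y → ¬ InOpenSegment (P y) v (P f))
  first-seen {C = C} C? v {w} Cw v≉w
    with minimal {Q = λ y → C y × det v (P w) (P y) ≈ 0# × 0# < dot v (P w) (P y)}
           {R = λ y m → dot v (P w) (P y) < dot v (P w) (P m)}
           (λ y → C? y ×-dec (det v (P w) (P y) ≟ 0#) ×-dec (0# <? dot v (P w) (P y)))
           (λ y m → dot v (P w) (P y) <? dot v (P w) (P m))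
           (λ _ → <-irrefl refl) (λ _ _ _ → <-trans)
           (Cw , det-abb v (P w) , dot-pos v (P w) v≉w)
  ... | f , (Cf , det≈0 , 0<dot) , low
    with collinear⇒interp {v} {P w} (P f) v≉w det≈0
  ...   | i , 0<i , Ni≈1 , Pf≈ = f , Cf , (g f * i , *-pos 0<dot 0<i , s≤1 , Pf≈) , unseen
    where
    g : Fin n → Carrier
    g y = dot v (P w) (P y)

    s≤1 : g f * i ≤F 1#
    s≤1 with compare (g f) (g w)
    ... | tri< gf<gw _ _ = inj₁ (<-respʳ-≈ Ni≈1 (0<y-x⇒x<y (<-respʳ-≈
      (solve 3 (λ x y i → (y :- x) :* i := y :* i :- x :* i) refl (g f) (g w) i) (*-pos (x<y⇒0<y-x gf<gw) 0<i))))
    ... | tri≈ _ gf≈gw _ = inj₂ (trans (*-congʳ gf≈gw) Ni≈1)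
    ... | tri> _ _ gw<gf = contradiction gw<gf (low w (Cw , det-abb v (P w) , dot-pos v (P w) v≉w))

    unseen : ∀ y → C y → ¬ InOpenSegment (P y) v (P f)
    unseen y Cy (t , 0<t , t<1 , e) = low y (Cy , dety≈0 , <-respʳ-≈ (sym gy≈t*gf) (*-pos 0<t 0<dot)) gy<gf
      where
      dety≈0 : det v (P w) (P y) ≈ 0#
      dety≈0 = trans (det-congʳ v (P w) {P y} {interp v (P f) t} e) (trans (det-interp v (P w) v (P f) t)
        (trans (lerp-cong t (det-aba v (P w)) det≈0) (trans (lerp-0ˡ 0# t) (zeroʳ t))))
      gy≈t*gf : g y ≈ t * g f
      gy≈t*gf = trans (dot-congʳ v (P w) {P y} {interp v (P f) t} e) (trans (dot-interp v (P w) v (P f) t)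
        (trans (lerp-cong t (dot-vwv v (P w)) refl) (lerp-0ˡ (g f) t)))
      gy<gf : g y < g f
      gy<gf = <-respˡ-≈ (sym gy≈t*gf) (0<y-x⇒x<y (<-respʳ-≈
        (solve 2 (λ t x → (con (+ 1) :- t) :* x := x :- t :* x) refl t (g f)) (*-pos (x<y⇒0<y-x t<1) 0<dot)))

  lexicographic-minimum : Fin n → ∃ λ r → ∀ p → p ≢ r → Beyond (P r) (P p)
  lexicographic-minimum x
    with minimal {Q = λ _ → ⊤} {R = λ y m → Beyond (P y) (P m)} (λ _ → yes tt) (λ y m → beyond? (P y) (P m))
           (λ {i} _ → beyond-irrefl {P i} {P i} (refl , refl)) (λ {i} {j} {k} _ _ _ → beyond-trans {P i} {P j} {P k}) {x} tt
  ... | r , _ , low = r , beyond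
    where
    beyond : ∀ p → p ≢ r → Beyond (P r) (P p)
    beyond p p≢r with beyond-compare (P r) (P p)
    ... | inj₁ r≺p = r≺p
    ... | inj₂ (inj₁ r≈p) = contradiction (P-injective p r (≈p-sym {P r} {P p} r≈p)) p≢r
    ... | inj₂ (inj₂ p≺r) = contradiction p≺r (low p tt)

-- Angular order around the root, hosts and spokes.

module Rooted {c ℓ₁ ℓ₂} (F : OrderedField c ℓ₁ ℓ₂) {n : ℕ} (P : Fin n → Plane.Point F)
  (P-injective : ∀ i j → Plane._≈p_ F (P i) (P j) → i ≡ j) (col : Fin n → Bool)
  (r : Fin n) (r-red : col r ≡ true) (r-min : ∀ p → p ≢ r → PlaneGeometry.Beyond F (P r) (P p)) where
  open OrderedField F hiding (zero) renaming (_<_ to infix 4 _<_; _≤F_ to infix 4 _≤F_)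
  open Plane F
  open OrderedFieldProperties F
  open PlaneGeometry F
  open PointConfiguration F P P-injective
  open Config P col

  Blue : Fin n → Set
  Blue b = col b ≡ false

  red-or-blue : ∀ i → col i ≡ true ⊎ Blue i
  red-or-blue i with col i
  ... | true = inj₁ ≡.refl
  ... | false = inj₂ ≡.refl

  red≢blue : ∀ {i j} → col i ≡ true → Blue j → i ≢ j
  red≢blue {i} i-red i-blue ≡.refl with ≡.trans (≡.sym i-red) i-blue
  ... | ()

  blue≢r : ∀ {b} → Blue b → b ≢ r
  blue≢r b-blue b≡r = red≢blue r-red b-blue (≡.sym b≡r)

  side : Fin n → Fin n → Carrier
  side q p = det (P r) (P q) (P p)

  -- The ray from r to p is clockwise from the ray from r to q.
  _≺_ : Fin n → Fin n → Set ℓ₂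
  p ≺ q = side q p < 0#

  side-self : ∀ p → side p p ≈ 0#
  side-self p = det-abb (P r) (P p)

  side-r : ∀ p → side p r ≈ 0#
  side-r p = det-aba (P r) (P p)

  side-swap : ∀ p q → side q p ≈ - side p q
  side-swap p q = det-swap (P r) (P p) (P q)

  side-interp : ∀ q {f} v w {s} → P f ≈p interp (P v) (P w) s → side q f ≈ lerp (side q v) (side q w) s
  side-interp q {f} v w {s} e =
    trans (det-congʳ (P r) (P q) {P f} {interp (P v) (P w) s} e) (det-interp (P r) (P q) (P v) (P w) s)

  ≺⇒pos : ∀ {p q} → p ≺ q → 0# < side p q
  ≺⇒pos {p} {q} p≺q = <-respʳ-≈ (sym (side-swap q p)) (neg⇒-pos p≺q)

  pos⇒≺ : ∀ {p q} → 0# < side p q → p ≺ q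
  pos⇒≺ {p} {q} 0<pq = <-respˡ-≈ (sym (side-swap p q)) (pos⇒-neg 0<pq)

  ≺-irrefl : ∀ {p} → ¬ p ≺ p
  ≺-irrefl {p} = <-irrefl (side-self p)

  ≺-trans : ∀ {p q s} → p ≢ r → q ≢ r → s ≢ r → p ≺ q → q ≺ s → p ≺ s
  ≺-trans {p} {q} {s} p≢r q≢r s≢r = det-trans {P r} {P p} {P q} {P s} (r-min p p≢r) (r-min q q≢r) (r-min s s≢r)

  Nearest : Fin n → Set _
  Nearest b = ∀ β → Blue β → ¬ InOpenSegment (P β) (P r) (P b)

  -- b is the last blue point on a ray clockwise from or through p, or p lies clockwise from all blue rays and b is on the first.
  Hosts : Fin n → Fin n → Set ℓ₂
  Hosts b p = (¬ p ≺ b × (∀ β → Blue β → ¬ p ≺ β → ¬ b ≺ β)) ⊎ (p ≺ b × (∀ β → Blue β → ¬ β ≺ b))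

  -- The ray is extremal in the angular order: greatest among the blue rays not counterclockwise
  -- from `p`, or least of all if there are none. The extremal `b₀` need not be the first blue point
  -- on its ray; passing to the first one multiplies every `side` involved by a positive factor, so
  -- the sign conditions survive.
  host : ∀ {β} → Blue β → ∀ p → ∃ λ b → Blue b × Nearest b × Hosts b p
  host {β} β-blue p with any? (λ b → (col b Bool.≟ false) ×-dec ¬? (side b p <? 0#))
  ... | yes (_ , Qb)
    with minimal {Q = λ b → Blue b × ¬ p ≺ b} {R = λ y m → m ≺ y}
           (λ b → (col b Bool.≟ false) ×-dec ¬? (side b p <? 0#)) (λ y m → side y m <? 0#)
           (λ {i} _ → ≺-irrefl {i})
           (λ {i} {j} {k} (i-blue , _) (j-blue , _) (k-blue , _) j≺i k≺j →
             ≺-trans {k} {j} {i} (blue≢r k-blue) (blue≢r j-blue) (blue≢r i-blue) k≺j j≺i) Qb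
  ...   | b₀ , (b₀-blue , ¬p≺b₀) , last
    with first-seen (λ b → col b Bool.≟ false) (P r) {b₀} b₀-blue (λ e → blue≢r b₀-blue (≡.sym (P-injective r b₀ e)))
  ...     | b , b-blue , (s , 0<s , _ , e) , nearest =
    b , b-blue , nearest , inj₁ (¬p≺b₀ ∘ *-neg-cancel 0<s ∘ <-respˡ-≈ (scale {P b} {P r} {P b₀} {s} e (P p)) ,
      λ q q-blue ¬p≺q b≺q → last q (q-blue , ¬p≺q)
        (*-neg-cancel 0<s (<-respˡ-≈ (trans (side-interp q {b} r b₀ e) (trans (lerp-cong s (side-r q) refl) (lerp-0ˡ _ s))) b≺q)))
  host {β} β-blue p | no none
    with minimal {Q = Blue} {R = _≺_} (λ b → col b Bool.≟ false) (λ y m → side m y <? 0#) (λ {i} _ → ≺-irrefl {i})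
           (λ {i} {j} {k} i-blue j-blue k-blue → ≺-trans {i} {j} {k} (blue≢r i-blue) (blue≢r j-blue) (blue≢r k-blue)) β-blue
  ...   | b₀ , b₀-blue , least
    with first-seen (λ b → col b Bool.≟ false) (P r) {b₀} b₀-blue (λ e → blue≢r b₀-blue (≡.sym (P-injective r b₀ e)))
  ...     | b , b-blue , (s , 0<s , _ , e) , nearest =
    b , b-blue , nearest , inj₂ (decidable-stable (side b p <? 0#) (λ ¬p≺b → none (b , b-blue , ¬p≺b)) ,
      λ q q-blue q≺b → least q q-blue (*-neg-cancel 0<s (<-respˡ-≈ (scale {P b} {P r} {P b₀} {s} e (P q)) q≺b)))

  -- The common interface of radial and pendant edges. `above` keeps `f` off the clockwise side of
  -- the ray of `b` unless that ray is the first blue one, and `below` keeps `f` short of every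
  -- later blue ray. The alternative `f ≡ r` is needed because `side β r` vanishes for each `β`.
  record Spoke (f b : Fin n) : Set (c Level.⊔ ℓ₁ Level.⊔ ℓ₂) where
    field
      red     : col f ≡ true
      blue    : Blue b
      visible : ∀ k → ¬ InOpenSegment (P k) (P b) (P f)
      nearest : Nearest b
      above   : ∀ β → Blue β → β ≺ b → ¬ f ≺ b
      below   : ∀ β → Blue β → b ≺ β → f ≡ r ⊎ f ≺ β

  det-rotate : ∀ {f b q} → det (P b) (P q) (P f) ≈ 0# → det (P f) (P b) (P q) ≈ 0#
  det-rotate {f} {b} {q} = trans (det-cycle (P f) (P b) (P q))

  lerp-vanish : ∀ {u v} t → u ≈ 0# → v ≈ 0# → lerp u v t ≈ 0#
  lerp-vanish t u≈0 v≈0 = trans (lerp-cong t u≈0 v≈0) (trans (lerp-0ˡ 0# t) (zeroʳ t))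

  det-on-interp : ∀ q {f} b w {s} → P f ≈p interp (P b) (P w) s → det (P b) (P q) (P w) ≈ 0# → det (P f) (P b) (P q) ≈ 0#
  det-on-interp q {f} b w {s} e bqw≈0 = det-rotate {f} {b} {q}
    (trans (det-congʳ (P b) (P q) {P f} {interp (P b) (P w) s} e) (trans (det-interp (P b) (P q) (P b) (P w) s)
      (lerp-vanish s (det-aba (P b) (P q)) bqw≈0)))

  -- The spoke representing p.  Either it lies on the ray from r through p, or it is a pendant edge at the host of p.
  spoke : ∀ {β} → Blue β → ∀ p → p ≢ r →
    ∃ λ f → ∃ λ b → Spoke f b × det (P f) (P b) (P p) ≈ 0# × (p ≡ b → det (P f) (P b) (P r) ≈ 0#)
  spoke β-blue p p≢r with host β-blue p
  ... | b , b-blue , nearest , hosts with side b p ≟ 0#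
  ...   | yes bp≈0
    with first-seen (λ _ → yes tt) (P b) {r} tt (blue≢r b-blue ∘ P-injective b r)
  ...     | f , _ , (s , 0<s , s≤1 , e) , visible =
    f , b , record
      { red = red s≤1 ; blue = b-blue ; visible = λ k → visible k tt ; nearest = nearest
      ; above = λ _ _ _ → <-irrefl (trans (side-interp b b r e) (lerp-vanish s (side-self b) (side-r b)))
      ; below = below s≤1 }
      , det-on-interp p b r e (trans (sym (det-cycle (P r) (P b) (P p))) bp≈0)
      , λ _ → det-on-interp r b r e (det-abb (P b) (P r))
    where
    f≡r : s ≈ 1# → f ≡ r
    f≡r s≈1 = P-injective f r (interp-end {P f} {P b} {P r} {s} e s≈1)

    -- A blue `f` strictly between `b` and `r` would contradict `nearest`; otherwise `f` is `r`.
    red : s ≤F 1# → col f ≡ true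
    red s≤1 with red-or-blue f | s≤1
    ... | inj₁ f-red | _ = f-red
    ... | inj₂ f-blue | inj₁ s<1 = contradiction (open-flip {P f} {P b} {P r} (s , 0<s , s<1 , e)) (nearest f f-blue)
    ... | inj₂ f-blue | inj₂ s≈1 = contradiction (f≡r s≈1) (blue≢r f-blue)

    below : s ≤F 1# → ∀ β → Blue β → b ≺ β → f ≡ r ⊎ f ≺ β
    below (inj₂ s≈1) _ _ _ = inj₁ (f≡r s≈1)
    below (inj₁ s<1) β _ b≺β = inj₂ (<-respˡ-≈
      (sym (trans (side-interp β b r e) (trans (lerp-cong s refl (side-r β)) (lerp-0ʳ (side β b) s))))
      (*-pos-neg (x<y⇒0<y-x s<1) b≺β))
  spoke β-blue p p≢r | b , b-blue , nearest , hosts | no bp≉0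
    with first-seen (λ _ → yes tt) (P b) {p} tt (p≢b ∘ ≡.sym ∘ P-injective b p)
    where
    p≢b : p ≢ b
    p≢b ≡.refl = bp≉0 (side-self b)
  ...     | f , _ , (s , 0<s , s≤1 , e) , visible =
    f , b , record
      { red = red hosts ; blue = b-blue ; visible = λ k → visible k tt ; nearest = nearest
      ; above = above hosts ; below = λ β β-blue b≺β → inj₂ (below hosts β β-blue b≺β) }
      , det-on-interp p b p e (det-abb (P b) (P p))
      , λ { ≡.refl → contradiction (side-self b) bp≉0 }
    where
    side-f : side b f ≈ s * side b p
    side-f = trans (side-interp b b p e) (trans (lerp-cong s (side-self b) refl) (lerp-0ˡ (side b p) s))

    ¬p≺b⇒b≺p : ¬ p ≺ b → b ≺ p
    ¬p≺b⇒b≺p ¬p≺b with compare (side b p) 0#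
    ... | tri< p≺b _ _ = contradiction p≺b ¬p≺b
    ... | tri≈ _ bp≈0 _ = contradiction bp≈0 bp≉0
    ... | tri> _ _ 0<bp = pos⇒≺ {b} {p} 0<bp

    ¬p≺b⇒0<bf : ¬ p ≺ b → 0# < side b f
    ¬p≺b⇒0<bf ¬p≺b = <-respʳ-≈ (sym side-f) (*-pos 0<s (≺⇒pos {b} {p} (¬p≺b⇒b≺p ¬p≺b)))

    p≺b⇒f≺b : p ≺ b → f ≺ b
    p≺b⇒f≺b p≺b = <-respˡ-≈ (sym side-f) (*-pos-neg 0<s p≺b)

    ¬p≺b⇒¬p≺f : s ≤F 1# → ¬ p ≺ b → ¬ p ≺ f
    ¬p≺b⇒¬p≺f s≤1 ¬p≺b p≺f = not-left s≤1 (<-respʳ-≈ pf≈ (≺⇒pos {p} {f} p≺f))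
      where
      pf≈ : side p f ≈ (1# - s) * side p b
      pf≈ = trans (side-interp p b p e) (trans (lerp-cong s refl (side-self p)) (lerp-0ʳ (side p b) s))
      not-left : s ≤F 1# → ¬ 0# < (1# - s) * side p b
      not-left (inj₁ s<1) = <-asym (*-pos-neg (x<y⇒0<y-x s<1) (¬p≺b⇒b≺p ¬p≺b))
      not-left (inj₂ s≈1) = <-irrefl (sym (trans (*-congʳ (trans (+-congˡ (-‿cong s≈1)) (-‿inverseʳ 1#))) (zeroˡ (side p b))))

    -- A blue `f` would lie strictly counterclockwise from the ray of `b` but not past that of `p`,
    -- so the host would not be on the last such ray. If `p` precedes all blue rays, so does `f`,
    -- since `side b f` has the sign of `side b p`.
    red : Hosts b p → col f ≡ true
    red hosts with red-or-blue f | hosts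
    ... | inj₁ f-red | _ = f-red
    ... | inj₂ f-blue | inj₁ (¬p≺b , last) =
      contradiction (pos⇒≺ {b} {f} (¬p≺b⇒0<bf ¬p≺b)) (last f f-blue (¬p≺b⇒¬p≺f s≤1 ¬p≺b))
    ... | inj₂ f-blue | inj₂ (p≺b , least) = contradiction (p≺b⇒f≺b p≺b) (least f f-blue)

    above : Hosts b p → ∀ β → Blue β → β ≺ b → ¬ f ≺ b
    above (inj₁ (¬p≺b , _)) _ _ _ = <-asym (¬p≺b⇒0<bf ¬p≺b)
    above (inj₂ (_ , least)) β β-blue β≺b = contradiction β≺b (least β β-blue)

    below : Hosts b p → ∀ β → Blue β → b ≺ β → f ≺ β
    below hosts β β-blue b≺β = <-respˡ-≈ (sym (side-interp β b p e)) (lerp-neg b≺β (p≺β hosts) (inj₁ 0<s) s≤1)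
      where
      p≺β : Hosts b p → p ≺ β
      p≺β (inj₁ (_ , last)) = decidable-stable (side β p <? 0#) (λ ¬p≺β → last β β-blue ¬p≺β b≺β)
      p≺β (inj₂ (p≺b , _)) = ≺-trans {p} {b} {β} p≢r (blue≢r b-blue) (blue≢r β-blue) p≺b b≺β

  -- Spokes do not cross.

  nearest-compare : ∀ {b b′} → Blue b → Blue b′ → Nearest b → Nearest b′ → b ≡ b′ ⊎ b ≺ b′ ⊎ b′ ≺ b
  nearest-compare {b} {b′} b-blue b′-blue near near′ with compare (side b b′) 0#
  ... | tri< b′≺b _ _ = inj₂ (inj₂ b′≺b)
  ... | tri> _ _ 0<bb′ = inj₂ (inj₁ (pos⇒≺ {b} {b′} 0<bb′))
  ... | tri≈ _ bb′≈0 _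
    with same-ray-beyond {P r} {P b} {P b′} (r-min b (blue≢r b-blue)) (r-min b′ (blue≢r b′-blue)) bb′≈0
  ...   | t , 0<t , e with same-ray {P r} {P b} {P b′} {t} 0<t e
  ...     | inj₁ b′∈rb = contradiction b′∈rb (near b′ b′-blue)
  ...     | inj₂ (inj₁ b′≈b) = inj₁ (≡.sym (P-injective b′ b b′≈b))
  ...     | inj₂ (inj₂ b∈rb′) = contradiction b∈rb′ (near′ b b-blue)

  -- For two hosts on different rays, `below` at the earlier one places `f` clockwise from the later
  -- ray, exactly where `above` at the later one forbids it.
  host-unique : ∀ {f b b′} → Spoke f b → Spoke f b′ → f ≢ r → b ≡ b′
  host-unique {f} {b} {b′} S S′ f≢r with nearest-compare (Spoke.blue S) (Spoke.blue S′) (Spoke.nearest S) (Spoke.nearest S′)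
  ... | inj₁ b≡b′ = b≡b′
  ... | inj₂ (inj₁ b≺b′) with Spoke.below S b′ (Spoke.blue S′) b≺b′
  ...   | inj₁ f≡r = contradiction f≡r f≢r
  ...   | inj₂ f≺b′ = contradiction f≺b′ (Spoke.above S′ b (Spoke.blue S) b≺b′)
  host-unique {f} {b} {b′} S S′ f≢r | inj₂ (inj₂ b′≺b) with Spoke.below S′ b (Spoke.blue S) b′≺b
  ...   | inj₁ f≡r = contradiction f≡r f≢r
  ...   | inj₂ f≺b = contradiction f≺b (Spoke.above S b′ (Spoke.blue S′) b′≺b)

  -- A common point other than `b` would put `f` and `f′` on one ray from `b`, where the nearer
  -- hides the farther.
  spokes-share-host : ∀ {f f′ b x} → Spoke f b → Spoke f′ b → f ≢ f′ →
    InClosedSegment x (P b) (P f) → InClosedSegment x (P b) (P f′) → x ≈p P b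
  spokes-share-host {f} {f′} {b} {x} S S′ f≢f′ (s , inj₂ 0≈s , _ , e) _ = interp-start {x} {P b} {P f} {s} e (sym 0≈s)
  spokes-share-host {f} {f′} {b} {x} S S′ f≢f′ _ (s , inj₂ 0≈s , _ , e) = interp-start {x} {P b} {P f′} {s} e (sym 0≈s)
  spokes-share-host {f} {f′} {b} {x} S S′ f≢f′ (s , inj₁ 0<s , _ , e) (s′ , inj₁ 0<s′ , _ , e′) =
    contradiction (same-ray {P b} {P f} {P f′} {s * i} (*-pos 0<s 0<i) f′≈) different-rays
    where
    i : Carrier
    i = proj₁ (pos-inverse 0<s′)

    0<i : 0# < i
    0<i = proj₁ (proj₂ (pos-inverse 0<s′))

    f′≈ : P f′ ≈p interp (P b) (P f) (s * i)
    f′≈ = interp-compose {P f′} {x} {P b} {P f} {s} {i} e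
      (interp-inverse {P f′} {x} {P b} {s′} {i} (proj₂ (proj₂ (pos-inverse 0<s′))) e′)

    different-rays : ¬ (InOpenSegment (P f′) (P b) (P f) ⊎ P f′ ≈p P f ⊎ InOpenSegment (P f) (P b) (P f′))
    different-rays (inj₁ f′∈bf) = Spoke.visible S f′ f′∈bf
    different-rays (inj₂ (inj₁ f′≈f)) = f≢f′ (≡.sym (P-injective f′ f f′≈f))
    different-rays (inj₂ (inj₂ f∈bf′)) = Spoke.visible S′ f f∈bf′

  -- The line through `r` and `b′` separates the two spokes: its functional `h` is nonnegative on
  -- the spoke at `b′` and negative on the one at `b`, except at an endpoint equal to `r`. Hence `x`
  -- is `r`, and by `beyond-segment` the second spoke reaches `r` only if `f′` is `r`.
  spokes-meet-at-r : ∀ {f b f′ b′ x} → Spoke f b → Spoke f′ b′ → b ≺ b′ →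
    InClosedSegment x (P b) (P f) → InClosedSegment x (P b′) (P f′) → f ≡ r × f′ ≡ r × x ≈p P r
  spokes-meet-at-r {f} {b} {f′} {b′} {x} S S′ b≺b′ (t , 0≤t , t≤1 , e) x∈b′f′@(t′ , 0≤t′ , t′≤1 , e′) =
    at-r (Spoke.below S b′ (Spoke.blue S′) b≺b′) t≤1
    where
    h : Point → Carrier
    h = det (P r) (P b′)

    hx≈ : h x ≈ lerp (h (P b)) (h (P f)) t
    hx≈ = trans (det-congʳ (P r) (P b′) {x} {interp (P b) (P f) t} e) (det-interp (P r) (P b′) (P b) (P f) t)

    hx≈′ : h x ≈ t′ * h (P f′)
    hx≈′ = trans (det-congʳ (P r) (P b′) {x} {interp (P b′) (P f′) t′} e′)
      (trans (det-interp (P r) (P b′) (P b′) (P f′) t′) (trans (lerp-cong t′ (side-self b′) refl) (lerp-0ˡ (h (P f′)) t′)))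

    ¬lerp<0 : 0# ≤F t′ → ¬ h x < 0#
    ¬lerp<0 0≤t′ hx<0 with compare (h (P f′)) 0# | 0≤t′
    ... | tri< f′≺b′ _ _ | _ = contradiction f′≺b′ (Spoke.above S′ b (Spoke.blue S) b≺b′)
    ... | tri≈ _ hf′≈0 _ | _ = <-irrefl (trans hx≈′ (trans (*-congˡ hf′≈0) (zeroʳ t′))) hx<0
    ... | tri> _ _ 0<hf′ | inj₁ 0<t′ = <-asym hx<0 (<-respʳ-≈ (sym hx≈′) (*-pos 0<t′ 0<hf′))
    ... | tri> _ _ 0<hf′ | inj₂ 0≈t′ = <-irrefl (trans hx≈′ (trans (*-congʳ (sym 0≈t′)) (zeroˡ (h (P f′))))) hx<0

    ¬hx<0 : ¬ h x < 0#
    ¬hx<0 = ¬lerp<0 0≤t′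

    at-r : f ≡ r ⊎ f ≺ b′ → t ≤F 1# → f ≡ r × f′ ≡ r × x ≈p P r
    at-r (inj₂ f≺b′) t≤1 = contradiction (<-respˡ-≈ (sym hx≈) (lerp-neg b≺b′ f≺b′ 0≤t t≤1)) ¬hx<0
    at-r (inj₁ f≡r) (inj₁ t<1) = contradiction
      (<-respˡ-≈ (sym (trans hx≈ (trans (lerp-cong t refl hf≈0) (lerp-0ʳ (h (P b)) t)))) (*-pos-neg (x<y⇒0<y-x t<1) b≺b′)) ¬hx<0
      where
      hf≈0 : h (P f) ≈ 0#
      hf≈0 = trans (reflexive (≡.cong (h ∘ P) f≡r)) (side-r b′)
    at-r (inj₁ ≡.refl) (inj₂ t≈1) = ≡.refl , f′≡r , x≈r
      where
      x≈r : x ≈p P r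
      x≈r = interp-end {x} {P b} {P r} {t} e t≈1
      f′≡r : f′ ≡ r
      f′≡r = decidable-stable (f′ Fin.≟ r) (λ f′≢r →
        beyond-segment {P r} {x} {P b′} {P f′} (r-min b′ (blue≢r (Spoke.blue S′))) (r-min f′ f′≢r) x∈b′f′ x≈r)

  spokes-noncrossing : ∀ {e e′} → Spoke (proj₁ e) (proj₂ e) → Spoke (proj₁ e′) (proj₂ e′) → e ≢ e′ → ∀ x →
    InClosedSegment x (P (proj₁ e)) (P (proj₂ e)) → InClosedSegment x (P (proj₁ e′)) (P (proj₂ e′)) →
    ∃ λ u → Endpoint u e × Endpoint u e′ × x ≈p P u
  spokes-noncrossing {f , b} {f′ , b′} S S′ e≢e′ x x∈fb x∈f′b′ =
    meet (nearest-compare (Spoke.blue S) (Spoke.blue S′) (Spoke.nearest S) (Spoke.nearest S′))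
    where
    x∈bf : InClosedSegment x (P b) (P f)
    x∈bf = closed-flip {x} {P f} {P b} x∈fb

    x∈b′f′ : InClosedSegment x (P b′) (P f′)
    x∈b′f′ = closed-flip {x} {P f′} {P b′} x∈f′b′

    meet : b ≡ b′ ⊎ b ≺ b′ ⊎ b′ ≺ b → ∃ λ u → Endpoint u (f , b) × Endpoint u (f′ , b′) × x ≈p P u
    meet (inj₁ ≡.refl) = b , inj₂ ≡.refl , inj₂ ≡.refl , spokes-share-host S S′ (e≢e′ ∘ ≡.cong (_, b)) x∈bf x∈b′f′
    meet (inj₂ (inj₁ b≺b′)) = let f≡r , f′≡r , x≈r = spokes-meet-at-r S S′ b≺b′ x∈bf x∈b′f′ in
      r , inj₁ (≡.sym f≡r) , inj₁ (≡.sym f′≡r) , x≈r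
    meet (inj₂ (inj₂ b′≺b)) = let f′≡r , f≡r , x≈r = spokes-meet-at-r S′ S b′≺b x∈b′f′ x∈bf in
      r , inj₁ (≡.sym f≡r) , inj₁ (≡.sym f′≡r) , x≈r

  -- Spokes form a forest.

  Spokes : List (Fin n × Fin n) → Set _
  Spokes E = ∀ e → e ∈ E → Spoke (proj₁ e) (proj₂ e)

  module _ {E : List (Fin n × Fin n)} (spokes : Spokes E) where
    adj-red : ∀ {u w} → col u ≡ true → Adj E u w → Spoke u w
    adj-red _ (inj₁ uw∈E) = spokes _ uw∈E
    adj-red u-red (inj₂ wu∈E) = contradiction ≡.refl (red≢blue u-red (Spoke.blue (spokes _ wu∈E)))

    adj-blue : ∀ {u w} → Blue u → Adj E u w → col w ≡ true
    adj-blue u-blue (inj₁ uw∈E) = contradiction ≡.refl (red≢blue (Spoke.red (spokes _ uw∈E)) u-blue)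
    adj-blue _ (inj₂ wu∈E) = Spoke.red (spokes _ wu∈E)

    -- r is the only red vertex with more than one neighbour, but at least two vertices of a cycle are red.
    acyclic : ¬ HasCycle E
    acyclic (m , v , v-injective , adj) = go (red-or-blue (v i₁))
      where
      i₀ i₁ i₂ i₃ : Fin (3 ℕ.+ m)
      i₀ = zero
      i₁ = next i₀
      i₂ = next i₁
      i₃ = next i₂

      red-is-root : ∀ i → next (next i) ≢ i → col (v (next i)) ≡ true → v (next i) ≡ r
      red-is-root i i″≢i red = decidable-stable (v (next i) Fin.≟ r) λ v≢r → i″≢i (≡.sym (v-injective i (next (next i))
        (host-unique (adj-red red (Sum.swap (adj i))) (adj-red red (adj (next i))) v≢r)))

      red-after-2 : ∀ i → col (v i) ≡ true → col (v (next (next i))) ≡ true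
      red-after-2 i red = adj-blue (Spoke.blue (adj-red red (adj i))) (adj (next i))

      -- Colours alternate, so a red vertex at `next i` is followed by a red one two places later.
      -- Each has two distinct neighbours, so both would be `r`.
      two-red : ∀ i → next (next i) ≢ i → next (next (next i)) ≢ next i → next (next (next (next i))) ≢ next (next i) →
        ¬ col (v (next i)) ≡ true
      two-red i i≢ i′≢ i″≢ red = i′≢ (v-injective (next (next (next i))) (next i)
        (≡.trans (red-is-root (next (next i)) i″≢ (red-after-2 (next i) red)) (≡.sym (red-is-root i i≢ red))))

      -- The recursion defining next is local to it, hence closed off from induction; near zero next simply computes.
      next²≢₁ : ∀ m → next (next (suc zero)) ≢ suc (zero {1 ℕ.+ m})
      next²≢₁ zero ()
      next²≢₁ (suc _) ()

      next²≢₂ : ∀ m → next (next (suc (suc zero))) ≢ suc (suc (zero {m}))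
      next²≢₂ 0 ()
      next²≢₂ 1 ()
      next²≢₂ (suc (suc _)) ()

      next²≢₃ : ∀ m → next (next (next (suc (suc zero)))) ≢ next (suc (suc (zero {m})))
      next²≢₃ 0 ()
      next²≢₃ 1 ()
      next²≢₃ 2 ()
      next²≢₃ (suc (suc (suc _))) ()

      go : ¬ (col (v i₁) ≡ true ⊎ Blue (v i₁))
      go (inj₁ red) = two-red i₀ (λ ()) (next²≢₁ m) (next²≢₂ m) red
      go (inj₂ blue) = two-red i₁ (next²≢₁ m) (next²≢₂ m) (next²≢₃ m) (adj-blue blue (adj i₁))

-- Counting a list by the fibres of a map.

lookup-injective : ∀ {a} {A : Set a} {xs : List A} → Unique xs → ∀ i j → lookup xs i ≡ lookup xs j → i ≡ j
lookup-injective (_ ∷ _) zero zero _ = ≡.refl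
lookup-injective {xs = x ∷ xs} (x∉ ∷ _) zero (suc j) eq = contradiction eq (All.lookup x∉ (∈-lookup j))
lookup-injective {xs = x ∷ xs} (x∉ ∷ _) (suc i) zero eq = contradiction (≡.sym eq) (All.lookup x∉ (∈-lookup i))
lookup-injective (_ ∷ uniq) (suc i) (suc j) eq = ≡.cong suc (lookup-injective uniq i j eq)

length-filter-¬ : ∀ {a p} {A : Set a} {Q : A → Set p} (Q? : ∀ x → Dec (Q x)) xs →
  length xs ≡ length (filter Q? xs) ℕ.+ length (filter (¬? ∘ Q?) xs)
length-filter-¬ Q? [] = ≡.refl
length-filter-¬ Q? (x ∷ xs) with Q? x
... | yes _ = ≡.cong suc (length-filter-¬ Q? xs)
... | no _ = ≡.trans (≡.cong suc (length-filter-¬ Q? xs)) (≡.sym (ℕ.+-suc _ _))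

length-fibres : ∀ {a b} {A : Set a} {B : Set b} (φ : A → B) → (∀ y z → Dec (y ≡ z)) → ∀ k →
  (∀ y xs → Unique xs → All (λ x → φ x ≡ y) xs → length xs ℕ.≤ k) →
  ∀ ys xs → Unique xs → All (λ x → φ x ∈ ys) xs → length xs ℕ.≤ k ℕ.* length ys
length-fibres φ _≟_ k fibre [] [] _ _ = ℕ.z≤n
length-fibres φ _≟_ k fibre [] (_ ∷ _) _ (() ∷ _)
length-fibres φ _≟_ k fibre (y ∷ ys) xs uniq covered = begin
  length xs                                           ≡⟨ length-filter-¬ y? xs ⟩
  length (filter y? xs) ℕ.+ length (filter (¬? ∘ y?) xs)  ≤⟨ ℕ.+-mono-≤
    (fibre y (filter y? xs) (Unique.filter⁺ y? uniq) (All.all-filter y? xs))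
    (length-fibres φ _≟_ k fibre ys (filter (¬? ∘ y?) xs) (Unique.filter⁺ (¬? ∘ y?) uniq)
      (All.tabulate λ x∈ → let x∈xs , φx≢y = ∈-filter⁻ (¬? ∘ y?) {xs = xs} x∈ in tail φx≢y (All.lookup covered x∈xs))) ⟩
  k ℕ.+ k ℕ.* length ys                               ≡⟨ ℕ.*-suc k (length ys) ⟨
  k ℕ.* suc (length ys)                               ∎
  where
  open ℕ.≤-Reasoning
  y? : ∀ x → Dec (φ x ≡ y)
  y? x = φ x ≟ y

-- The edge set for a red root: size and connectedness.

module Forests {c ℓ₁ ℓ₂} (F : OrderedField c ℓ₁ ℓ₂) {m : ℕ} (P : Fin (suc m) → Plane.Point F)
  (P-injective : ∀ i j → Plane._≈p_ F (P i) (P j) → i ≡ j) (col : Fin (suc m) → Bool)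
  (r : Fin (suc m)) (r-red : col r ≡ true) (r-min : ∀ p → p ≢ r → PlaneGeometry.Beyond F (P r) (P p))
  {β : Fin (suc m)} (β-blue : col β ≡ false) where
  open OrderedField F using (_≈_; 0#)
  open Plane F
  open OrderedFieldProperties F
  open PlaneGeometry F
  open Rooted F P P-injective col r r-red r-min
  open Config P col

  others : Fin m → Fin (suc m)
  others = punchIn r

  -- `radial` reserves a spare point on the line of every edge: an edge may represent its own blue
  -- endpoint only if its line also passes through `r`, which is not among the points counted.
  record Represents (e : Fin (suc m) × Fin (suc m)) (p : Fin (suc m)) : Set (c Level.⊔ ℓ₁ Level.⊔ ℓ₂) where
    field
      is-spoke  : Spoke (proj₁ e) (proj₂ e)
      on-line   : det (P (proj₁ e)) (P (proj₂ e)) (P p) ≈ 0#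
      radial    : p ≡ proj₂ e → det (P (proj₁ e)) (P (proj₂ e)) (P r) ≈ 0#

  representative : ∀ j → ∃ λ e → Represents e (others j)
  representative j = let f , b , S , line , rad = spoke β-blue (others j) (punchInᵢ≢i r j) in
    (f , b) , record { is-spoke = S ; on-line = line ; radial = rad }

  edge : Fin m → Fin (suc m) × Fin (suc m)
  edge j = proj₁ (representative j)

  _≟e_ : ∀ (e e′ : Fin (suc m) × Fin (suc m)) → Dec (e ≡ e′)
  _≟e_ = ≡-dec Fin._≟_ Fin._≟_

  edges : List (Fin (suc m) × Fin (suc m))
  edges = deduplicate _≟e_ (tabulate edge)

  edge∈edges : ∀ j → edge j ∈ edges
  edge∈edges j = ∈-deduplicate⁺ _≟e_ (∈-tabulate⁺ j)

  edges-spokes : Spokes edges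
  edges-spokes e e∈ = let j , e≡ = ∈-tabulate⁻ (∈-deduplicate⁻ _≟e_ (tabulate edge) e∈) in
    ≡.subst (λ e → Spoke (proj₁ e) (proj₂ e)) (≡.sym e≡) (Represents.is-spoke (proj₂ (representative j)))

  edges-bivisible : All BivisEdge edges
  edges-bivisible = All.tabulate λ {e} e∈ → let S = edges-spokes e e∈ in
    Spoke.red S , Spoke.blue S , λ k k∈fb → Spoke.visible S k (open-flip {P k} {P (proj₁ e)} {P (proj₂ e)} k∈fb)

  edges-noncrossing : NonCrossing edges
  edges-noncrossing e e′ e∈ e′∈ = spokes-noncrossing {e} {e′} (edges-spokes e e∈) (edges-spokes e′ e′∈)

  edges-forest : Forest edges
  edges-forest = deduplicate-! _≟e_ (tabulate edge) , acyclic edges-spokes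

  module _ {ℓ} (AB-lines : ABLinesAtMost ℓ) where
    collinear-length : ∀ {f b} → Spoke f b → ∀ {xs} → Unique xs → All (λ p → det (P f) (P b) (P p) ≈ 0#) xs → length xs ℕ.≤ ℓ
    collinear-length {f} {b} S {xs} uniq line = AB-lines f b (Spoke.red S) (Spoke.blue S) (length xs) (lookup xs)
      (lookup-injective uniq) (λ i → det≈0⇒OnLine (All.lookup line (∈-lookup i)))

    fibre-length : ∀ e xs → Unique xs → All (λ j → edge j ≡ e) xs → length xs ℕ.≤ ℓ ℕ.∸ 1
    -- Only a represented point certifies that `e` is a spoke, so the empty fibre is settled
    -- separately.
    fibre-length e [] _ _ = ℕ.z≤n
    fibre-length e xs@(_ ∷ _) uniq fib = ≡.subst (ℕ._≤ ℓ ℕ.∸ 1) (length-map others xs) (ℕ.∸-monoˡ-≤ 1 bound)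
      where
      represents : All (λ j → Represents e (others j)) xs
      represents = All.map (λ {j} eq → ≡.subst (λ e → Represents e (others j)) eq (proj₂ (representative j))) fib

      line : All (λ p → det (P (proj₁ e)) (P (proj₂ e)) (P p) ≈ 0#) (map others xs)
      line = All.map⁺ (All.map Represents.on-line represents)

      uniq′ : Unique (map others xs)
      uniq′ = Unique.map⁺ (punchIn-injective r _ _) uniq

      S : Spoke (proj₁ e) (proj₂ e)
      S = Represents.is-spoke (All.head represents)

      -- The line through e also contains r if e is radial, and otherwise the host of e, which e does not represent.
      bound : suc (length (map others xs)) ℕ.≤ ℓ
      bound = extra (det (P (proj₁ e)) (P (proj₂ e)) (P r) ≟ 0#)
        where
        extra : Dec (det (P (proj₁ e)) (P (proj₂ e)) (P r) ≈ 0#) → suc (length (map others xs)) ℕ.≤ ℓ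
        extra (yes r-on) =
          collinear-length S {r ∷ _} (All.map⁺ (All.universal (λ j → punchInᵢ≢i r j ∘ ≡.sym) xs) ∷ uniq′) (r-on ∷ line)
        extra (no r-off) = collinear-length S {proj₂ e ∷ _}
          (All.map⁺ (All.map (λ R b≡p → r-off (Represents.radial R (≡.sym b≡p))) represents) ∷ uniq′)
          (det-abb (P (proj₁ e)) (P (proj₂ e)) ∷ line)

    edges-length : m ℕ.≤ (ℓ ℕ.∸ 1) ℕ.* length edges
    edges-length = ≡.subst (ℕ._≤ (ℓ ℕ.∸ 1) ℕ.* length edges) (length-tabulate {n = m} id)
      (length-fibres edge _≟e_ (ℓ ℕ.∸ 1) fibre-length edges (allFin m) (Unique.allFin⁺ m) (All.tabulate⁺ edge∈edges))

  module _ (AB-lines : ABLinesAtMost 2) where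
    -- Otherwise `p`, `f` and `b` are three distinct points on one AB-line.
    endpoint : ∀ {f b p} → Spoke f b → det (P f) (P b) (P p) ≈ 0# → p ≡ f ⊎ p ≡ b
    endpoint {f} {b} {p} S line with p Fin.≟ f | p Fin.≟ b
    ... | yes p≡f | _ = inj₁ p≡f
    ... | no _ | yes p≡b = inj₂ p≡b
    ... | no p≢f | no p≢b = contradiction
      (collinear-length AB-lines S {p ∷ f ∷ b ∷ []}
        ((p≢f ∷ p≢b ∷ []) ∷ (red≢blue (Spoke.red S) (Spoke.blue S) ∷ []) ∷ [] ∷ [])
        (line ∷ det-aba (P f) (P b) ∷ det-abb (P f) (P b) ∷ []))
      (λ { (ℕ.s≤s (ℕ.s≤s ())) })

    representing : ∀ {p} → p ≢ r → ∃ λ e → e ∈ edges × Represents e p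
    representing {p} p≢r = ≡.subst (λ q → ∃ λ e → e ∈ edges × Represents e q) (punchIn-punchOut (p≢r ∘ ≡.sym))
      (let j = punchOut (p≢r ∘ ≡.sym) in edge j , edge∈edges j , proj₂ (representative j))

    -- The edge representing `b` has `b` as an endpoint, necessarily the blue one. Then `radial`
    -- puts `r` on its line, so `r` must be the other endpoint.
    blue-adjacent : ∀ {b} → Blue b → (r , b) ∈ edges
    blue-adjacent {b} b-blue = let e , e∈ , R = representing (blue≢r b-blue) in
      at-host e∈ R (endpoint (Represents.is-spoke R) (Represents.on-line R))
      where
      radial-edge : ∀ {f} → (f , b) ∈ edges → Spoke f b → r ≡ f ⊎ r ≡ b → (r , b) ∈ edges
      radial-edge e∈ _ (inj₁ ≡.refl) = e∈
      radial-edge _ S (inj₂ r≡b) = contradiction r≡b (red≢blue r-red (Spoke.blue S))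

      at-host : ∀ {f b′} → (f , b′) ∈ edges → Represents (f , b′) b → b ≡ f ⊎ b ≡ b′ → (r , b) ∈ edges
      at-host _ R (inj₁ b≡f) = contradiction (≡.sym b≡f) (red≢blue (Spoke.red (Represents.is-spoke R)) b-blue)
      at-host e∈ R (inj₂ ≡.refl) = radial-edge e∈ (Represents.is-spoke R)
        (endpoint (Represents.is-spoke R) (Represents.radial R ≡.refl))

    -- The point `p` is an endpoint of its representing edge, whose blue end is adjacent to `r`; a
    -- path of at most two edges suffices.
    connected-to-r : ∀ p → Star (Adj edges) p r
    connected-to-r p with p Fin.≟ r
    ... | yes ≡.refl = ε
    ... | no p≢r = let e , e∈ , R = representing p≢r in
      via e∈ (Represents.is-spoke R) (endpoint (Represents.is-spoke R) (Represents.on-line R))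
      where
      via : ∀ {f b} → (f , b) ∈ edges → Spoke f b → p ≡ f ⊎ p ≡ b → Star (Adj edges) p r
      via e∈ S (inj₁ ≡.refl) = inj₁ e∈ ◅ inj₂ (blue-adjacent (Spoke.blue S)) ◅ ε
      via _ S (inj₂ ≡.refl) = inj₂ (blue-adjacent (Spoke.blue S)) ◅ ε

    edges-connected : Connected edges
    edges-connected u v = connected-to-r u ◅◅ reverse Sum.swap (connected-to-r v)

-- Exchange of the two colours.

module ColourSwap {c ℓ₁ ℓ₂} (F : OrderedField c ℓ₁ ℓ₂) {n : ℕ} (P : Fin n → Plane.Point F) (col : Fin n → Bool) where
  open Plane F
  open PlaneGeometry F
  open Config P col
  private module Swapped = Config P (not ∘ col)

  not-flip : ∀ {x y} → not x ≡ y → x ≡ not y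
  not-flip {x} eq = ≡.trans (≡.sym (not-involutive x)) (≡.cong not eq)

  swap-∈ : ∀ {u v : Fin n} {E} → (u , v) ∈ map swap E → (v , u) ∈ E
  swap-∈ {E = E} uv∈ = let e , e∈ , uv≡ = ∈-map⁻ swap uv∈ in ≡.subst (_∈ E) (≡.sym (≡.cong swap uv≡)) e∈

  swap-adj : ∀ {E u v} → Adj (map swap E) u v → Adj E u v
  swap-adj (inj₁ uv∈) = inj₂ (swap-∈ uv∈)
  swap-adj (inj₂ vu∈) = inj₁ (swap-∈ vu∈)

  adj-swap : ∀ {E u v} → Adj E u v → Adj (map swap E) u v
  adj-swap (inj₁ uv∈) = inj₂ (∈-map⁺ swap uv∈)
  adj-swap (inj₂ vu∈) = inj₁ (∈-map⁺ swap vu∈)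

  swap-AB-lines : ∀ {ℓ} → ABLinesAtMost ℓ → Swapped.ABLinesAtMost ℓ
  swap-AB-lines lines a b a-red b-blue k f f-injective line =
    lines b a (not-flip b-blue) (not-flip a-red) k f f-injective (λ i → OnLine-flip {P b} {P a} {P (f i)} (line i))

  swap-bivisible : ∀ {E} → All Swapped.BivisEdge E → All BivisEdge (map swap E)
  swap-bivisible = All.map⁺ ∘ All.map λ { {a , b} (a-red , b-blue , visible) →
    not-flip b-blue , not-flip a-red , λ k k∈ba → visible k (open-flip {P k} {P b} {P a} k∈ba) }

  -- Stated over `col` on both sides: `NonCrossing`, like `Forest` and `Connected`, unfolds to the
  -- same type for `col` and `not ∘ col`, so facts about edges built for the exchanged colours can
  -- be passed in directly.
  swap-noncrossing : ∀ {E} → NonCrossing E → NonCrossing (map swap E)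
  swap-noncrossing noncrossing (a , b) (a′ , b′) e∈ e′∈ e≢e′ x x∈ab x∈a′b′ =
    let u , u∈e , u∈e′ , x≈u = noncrossing (b , a) (b′ , a′) (swap-∈ e∈) (swap-∈ e′∈) (e≢e′ ∘ ≡.cong swap) x
          (closed-flip {x} {P a} {P b} x∈ab) (closed-flip {x} {P a′} {P b′} x∈a′b′)
    in u , Sum.swap u∈e , Sum.swap u∈e′ , x≈u

  swap-forest : ∀ {E} → Forest E → Forest (map swap E)
  swap-forest (unique , acyclic) = Unique.map⁺ {f = swap} (≡.cong swap) unique ,
    λ { (m , v , v-injective , adj) → acyclic (m , v , v-injective , λ i → swap-adj {_} {v i} {v (next i)} (adj i)) }

  swap-connected : ∀ {E} → Connected E → Connected (map swap E)
  swap-connected connected u v = Star.map (λ {x} {y} → adj-swap {_} {x} {y}) (connected u v)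

-- Choice of the root and of the colour to be called red.

open import Data.Nat using (_≤_; _∸_; _*_)

theorem14 : ∀ {c ℓ₁ ℓ₂ : Level} (F : OrderedField c ℓ₁ ℓ₂) (n ℓ : ℕ)
    (P : Fin n → Plane.Point F) (col : Fin n → Bool) →
    (∀ i j → Plane._≈p_ F (P i) (P j) → i ≡ j) →
    ∃ (λ a → col a ≡ true) → ∃ (λ b → col b ≡ false) →
    Plane.Config.ABLinesAtMost F P col ℓ →
    (∃ λ E → All (Plane.Config.BivisEdge F P col) E
    × Plane.Config.NonCrossing F P col E
    × Plane.Config.Forest F P col E
    × (n ∸ 1 ≤ (ℓ ∸ 1) * length E))
    × (ℓ ≡ 2 → ∃ λ E → All (Plane.Config.BivisEdge F P col) E
    × Plane.Config.NonCrossing F P col E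
    × Plane.Config.SpanningTree F P col E)
theorem14 F zero ℓ P col P-injective (() , _) _ _
theorem14 F (suc m) ℓ P col P-injective (a , a-red) (b , b-blue) AB-lines
  with PointConfiguration.lexicographic-minimum F P P-injective a
... | r , r-min with col r in r-col
...   | true =
  (edges , edges-bivisible , edges-noncrossing , edges-forest , edges-length AB-lines) ,
  λ { ≡.refl → edges , edges-bivisible , edges-noncrossing , edges-forest , edges-connected AB-lines }
  where open Forests F P P-injective col r r-col r-min b-blue
-- The root is blue. After the exchange it is red, and `a` serves as the blue point that `Forests`
-- requires; reversing the pairs restores the orientation that `BivisEdge` prescribes.
...   | false =
  (map swap edges , swap-bivisible edges-bivisible , swap-noncrossing edges-noncrossing , swap-forest edges-forest ,
    ≡.subst (λ k → m ≤ (ℓ ∸ 1) * k) (≡.sym (length-map swap edges)) (edges-length (swap-AB-lines AB-lines))) ,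
  λ { ≡.refl → map swap edges , swap-bivisible edges-bivisible , swap-noncrossing edges-noncrossing ,
    swap-forest edges-forest , swap-connected (edges-connected (swap-AB-lines AB-lines)) }
  where
  open ColourSwap F P col
  open Forests F P P-injective (not ∘ col) r (≡.cong not r-col) r-min (≡.cong not a-red)
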